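{- If $M$ is a well-formed term and $[\mathcal{Q},\mathcal{QV},M]\to^*[\mathcal{Q}',\mathcal{QV}',M']$, then $M'$ is well formed.
   Context: The Q-calculus. Fix an effective enumeration $(\mathbf{U}_i)_{i<\omega}$ of computable unitary operators $\mathbf{U}_i:\mathbb{C}^{2^{n_i}}\to\mathbb{C}^{2^{n_i}}$, with constant symbols $U_i$. Terms: classical variables $x$; quantum variables $r$; patterns $\pi::=x\mid\langle x_1,\dots,x_n\rangle$; constants $C::=0\mid 1\mid U_i$; terms $M::=x\mid r\mid\ !M\mid C\mid \mathtt{new}(M)\mid (M_1)M_2\mid\langle M_1,\dots,M_n\rangle\ (n\ge2)\mid \lambda!x.M\mid\lambda\pi.M$, modulo $\alpha$-conversion. $\mathrm{Q}(M)$ is the set of quantum variables occurring in $M$. An environment is a multiset of patterns, items $!x$ and quantum variables, each variable name occurring at most once; $!\Gamma$ denotes $!x_1,\dots,!x_n$ for $\Gamma=x_1,\dots,x_n$. A judgement $\Gamma\vdash M$ is well formed if derivable by: $\vdash C$; $r\vdash r$; $x\vdash x$; from $\Gamma\vdash M$ infer $\Gamma,!x\vdash M$; from $\Gamma,!x,!y\vdash M$ infer $\Gamma,!z\vdash M\{z/x,z/y\}$; from $!\Gamma\vdash M$ infer $!\Gamma\vdash !M$; from $\Gamma,x\vdash M$ infer $\Gamma,!x\vdash M$; from $\Gamma,x_1,\dots,x_k\vdash M$ infer $\Gamma,\langle x_1,\dots,x_k\rangle\vdash M$; from $\Gamma_i\vdash M_i$ ($i\le k$) infer $\Gamma_1,\dots,\Gamma_k\vdash\langle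 M_1,\dots,M_k\rangle$; from $\Gamma\vdash M$ infer $\Gamma\vdash\mathtt{new}(M)$; from $\Gamma,\pi\vdash M$ infer $\Gamma\vdash\lambda\pi.M$; from $\Gamma,!x\vdash M$ infer $\Gamma\vdash\lambda!x.M$; from $\Gamma_1\vdash M_1$, $\Gamma_2\vdash M_2$ infer $\Gamma_1,\Gamma_2\vdash(M_1)M_2$. A term $M$ is well formed if $\mathrm{Q}(M)\vdash M$ is well formed. For a finite set $V$ of quantum variables, $\mathcal{H}(V)$ is the Hilbert space of functions $\{0,1\}^V\to\mathbb{C}$ with basis $\{|f\rangle\}$, with $\mathcal{H}(V)\otimes\mathcal{H}(V')\cong\mathcal{H}(V\cup V')$ for disjoint $V,V'$; $\mathbf{U}_{\langle\langle r_1,\dots,r_n\rangle\rangle}$ acts as $\mathbf{U}$ on qubits $r_1,\dots,r_n$ and as identity elsewhere. A (pre)configuration $[\mathcal{Q},\mathcal{QV},M]$ has $\mathcal{QV}$ finite, $\mathcal{Q}\in\mathcal{H}(\mathcal{QV})$, $\mathrm{Q}(M)\subseteq\mathcal{QV}$; configurations are taken modulo bijective renaming of quantum variables and are well formed if $\Gamma\vdash M$ is well formed for some $\Gamma$. Reduction on well-formed configurations is given by the axioms ($\mathsf{Uq}$) $[\mathcal{Q},\mathcal{QV},U\langle r_1,\dots,r_n\rangle]\to[\mathbf{U}_{\langle\langle r_1,\dots,r_n\rangle\rangle}\mathcal{Q},\mathcal{QV},\langle r_1,\dots,r_n\rangle]$; ($\mathsf{new}$) $[\mathcal{Q},\mathcal{QV},\mathtt{new}(c)]\to[\mathcal{Q}\otimes|r\mapsto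 c\rangle,\mathcal{QV}\cup\{r\},r]$, $c\in\{0,1\}$, $r$ fresh; and, leaving $\mathcal{Q},\mathcal{QV}$ unchanged, ($\mathsf{l.\beta}$) $(\lambda x.M)N\to M\{N/x\}$; ($\mathsf{q.\beta}$) $(\lambda\langle x_1,\dots,x_n\rangle.M)\langle r_1,\dots,r_n\rangle\to M\{r_i/x_i\}_i$; ($\mathsf{c.\beta}$) $(\lambda!x.M)!N\to M\{N/x\}$; ($\mathsf{l.cm}$) $L((\lambda\pi.M)N)\to(\lambda\pi.LM)N$; ($\mathsf{r.cm}$) $((\lambda\pi.M)N)L\to(\lambda\pi.ML)N$; closed under tuple components, both sides of application, and the body of $\lambda\pi.(\cdot)$ (not inside $!M$). $\to^*$ is the reflexive–transitive closure. -}

module Defs where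

-- Q-calculus (Dal Lago–Masini–Zorzi style), syntax in locally nameless form.
-- Classical bound variables are de Bruijn pairs (binder index, component);
-- free classical variables and quantum variables are names (ℕ).
-- This makes terms canonical modulo α-conversion.

open import Data.Nat using (ℕ; zero; suc; _≟_)
open import Data.Bool using (Bool; true; false)
open import Data.List using (List; []; _∷_; _++_; map; length; concat; concatMap)
open import Data.List.Membership.Propositional using (_∈_; _∉_)
open import Data.List.Relation.Unary.All using (All)
open import Data.List.Relation.Unary.Unique.Propositional using (Unique)
open import Data.List.Relation.Binary.Permutation.Propositional using (_↭_)
open import Data.List.Relation.Binary.Pointwise using (Pointwise)
open import Data.Product using (_×_; Σ; ∃; _,_)
open import Relation.Nullary using (yes; no)
open import Relation.Binary.PropositionalEquality using (_≡_)
open import Relation.Binary.Construct.Closure.ReflexiveTransitive using (Star)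

data Term : Set where
  var  : ℕ → Term
  bv   : ℕ → ℕ → Term           -- bound classical variable (binder index, component)
  qv   : ℕ → Term
  !_   : Term → Term
  c0   : Term
  c1   : Term
  U    : ℕ → Term
  new  : Term → Term
  _·_  : Term → Term → Term
  tup  : Term → Term → List Term → Term
  ƛ!   : Term → Term
  ƛv   : Term → Term
  ƛt   : ℕ → Term → Term        -- λ⟨x₁,…,x_{n+2}⟩.M  (binds n+2 variables)

infixl 5 _·_

pick : List Term → ℕ → Term → Term
pick []       _       d = d
pick (u ∷ us) zero    d = u
pick (u ∷ us) (suc j) d = pick us j d

mutual
  inst : ℕ → List Term → Term → Term
  inst k us (var x)    = var x
  inst k us (bv i j) with i ≟ k
  ... | yes _ = pick us j (bv i j)
  ... | no  _ = bv i j
  inst k us (qv r)     = qv r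
  inst k us (! M)      = ! inst k us M
  inst k us c0         = c0
  inst k us c1         = c1
  inst k us (U i)      = U i
  inst k us (new M)    = new (inst k us M)
  inst k us (M · N)    = inst k us M · inst k us N
  inst k us (tup M N Ms) = tup (inst k us M) (inst k us N) (instL k us Ms)
  inst k us (ƛ! M)     = ƛ! (inst (suc k) us M)
  inst k us (ƛv M)     = ƛv (inst (suc k) us M)
  inst k us (ƛt n M)   = ƛt n (inst (suc k) us M)

  instL : ℕ → List Term → List Term → List Term
  instL k us []       = []
  instL k us (M ∷ Ms) = inst k us M ∷ instL k us Ms

open0 : List Term → Term → Term
open0 = inst 0

mutual
  fv : Term → List ℕ
  fv (var x)      = x ∷ []
  fv (bv _ _)     = []
  fv (qv _)       = []
  fv (! M)        = fv M
  fv c0           = []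
  fv c1           = []
  fv (U _)        = []
  fv (new M)      = fv M
  fv (M · N)      = fv M ++ fv N
  fv (tup M N Ms) = fv M ++ fv N ++ fvL Ms
  fv (ƛ! M)       = fv M
  fv (ƛv M)       = fv M
  fv (ƛt _ M)     = fv M

  fvL : List Term → List ℕ
  fvL []       = []
  fvL (M ∷ Ms) = fv M ++ fvL Ms

mutual
  Qv : Term → List ℕ
  Qv (var _)      = []
  Qv (bv _ _)     = []
  Qv (qv r)       = r ∷ []
  Qv (! M)        = Qv M
  Qv c0           = []
  Qv c1           = []
  Qv (U _)        = []
  Qv (new M)      = Qv M
  Qv (M · N)      = Qv M ++ Qv N
  Qv (tup M N Ms) = Qv M ++ Qv N ++ QvL Ms
  Qv (ƛ! M)       = Qv M
  Qv (ƛv M)       = Qv M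
  Qv (ƛt _ M)     = Qv M

  QvL : List Term → List ℕ
  QvL []       = []
  QvL (M ∷ Ms) = Qv M ++ QvL Ms

mutual
  ren : ℕ → ℕ → Term → Term
  ren x z (var y) with y ≟ x
  ... | yes _ = var z
  ... | no  _ = var y
  ren x z (bv i j)     = bv i j
  ren x z (qv r)       = qv r
  ren x z (! M)        = ! ren x z M
  ren x z c0           = c0
  ren x z c1           = c1
  ren x z (U i)        = U i
  ren x z (new M)      = new (ren x z M)
  ren x z (M · N)      = ren x z M · ren x z N
  ren x z (tup M N Ms) = tup (ren x z M) (ren x z N) (renL x z Ms)
  ren x z (ƛ! M)       = ƛ! (ren x z M)
  ren x z (ƛv M)       = ƛv (ren x z M)
  ren x z (ƛt n M)     = ƛt n (ren x z M)

  renL : ℕ → ℕ → List Term → List Term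
  renL x z []       = []
  renL x z (M ∷ Ms) = ren x z M ∷ renL x z Ms

data Pattern : Set where
  pvar : ℕ → Pattern
  ptup : ℕ → ℕ → List ℕ → Pattern

data Item : Set where
  pat  : Pattern → Item
  bang : ℕ → Item
  qit  : ℕ → Item

Env : Set
Env = List Item

cnames : Item → List ℕ
cnames (pat (pvar x))      = x ∷ []
cnames (pat (ptup x y xs)) = x ∷ y ∷ xs
cnames (bang x)            = x ∷ []
cnames (qit _)             = []

qnames : Item → List ℕ
qnames (qit r) = r ∷ []
qnames _       = []

ValidEnv : Env → Set
ValidEnv Γ = Unique (concatMap cnames Γ) × Unique (concatMap qnames Γ)

bangs : List ℕ → Env
bangs = map bang

pvars : List ℕ → Env
pvars = map (λ x → pat (pvar x))

-- Well-formedness judgements Γ ⊢ M  (environments are multisets: exchange rule)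

infix 3 _⊢_

data _⊢_ : Env → Term → Set where
  ax-c0  : [] ⊢ c0
  ax-c1  : [] ⊢ c1
  ax-U   : ∀ i → [] ⊢ U i
  ax-q   : ∀ r → (qit r ∷ []) ⊢ qv r
  ax-x   : ∀ x → (pat (pvar x) ∷ []) ⊢ var x
  weak   : ∀ {Γ M} x → Γ ⊢ M → ValidEnv (bang x ∷ Γ) → (bang x ∷ Γ) ⊢ M
  contr  : ∀ {Γ M} x y z → (bang x ∷ bang y ∷ Γ) ⊢ M → ValidEnv (bang z ∷ Γ) →
           (bang z ∷ Γ) ⊢ ren y z (ren x z M)
  prom   : ∀ {M} xs → bangs xs ⊢ M → bangs xs ⊢ ! M
  derel  : ∀ {Γ M} x → (pat (pvar x) ∷ Γ) ⊢ M → (bang x ∷ Γ) ⊢ M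
  tpat   : ∀ {Γ M} x y xs → (pvars (x ∷ y ∷ xs) ++ Γ) ⊢ M → (pat (ptup x y xs) ∷ Γ) ⊢ M
  tupI   : ∀ {Γ₁ Γ₂ Γs M₁ M₂ Ms} → Γ₁ ⊢ M₁ → Γ₂ ⊢ M₂ → Pointwise _⊢_ Γs Ms →
           ValidEnv (Γ₁ ++ Γ₂ ++ concat Γs) → (Γ₁ ++ Γ₂ ++ concat Γs) ⊢ tup M₁ M₂ Ms
  newI   : ∀ {Γ M} → Γ ⊢ M → Γ ⊢ new M
  lamV   : ∀ {Γ M} x → x ∉ fv M → (pat (pvar x) ∷ Γ) ⊢ open0 (var x ∷ []) M → Γ ⊢ ƛv M
  lamT   : ∀ {Γ M} x y xs → All (_∉ fv M) (x ∷ y ∷ xs) →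
           (pat (ptup x y xs) ∷ Γ) ⊢ open0 (map var (x ∷ y ∷ xs)) M → Γ ⊢ ƛt (length xs) M
  lamB   : ∀ {Γ M} x → x ∉ fv M → (bang x ∷ Γ) ⊢ open0 (var x ∷ []) M → Γ ⊢ ƛ! M
  appI   : ∀ {Γ₁ Γ₂ M₁ M₂} → Γ₁ ⊢ M₁ → Γ₂ ⊢ M₂ → ValidEnv (Γ₁ ++ Γ₂) → (Γ₁ ++ Γ₂) ⊢ M₁ · M₂
  exch   : ∀ {Γ Δ M} → Γ ⊢ M → Γ ↭ Δ → Δ ⊢ M

-- A term M is well formed if Q(M) ⊢ M is well formed
-- (Q(M) as a duplicate-free list of quantum-variable items, order irrelevant by exch).
WellFormedTerm : Term → Set
WellFormedTerm M = Σ (List ℕ) λ qs →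
  Unique qs × (∀ r → (r ∈ qs → r ∈ Qv M) × (r ∈ Qv M → r ∈ qs)) × (map qit qs ⊢ M)

-- Quantum-register model.  The Hilbert-space state is abstracted: the term
-- component of reduction never inspects it.

record QModel : Set₁ where
  field
    arity  : ℕ → ℕ                          -- n_i  (U_i acts on 2^{n_i} dimensions)
    State  : Set
    applyU : ℕ → List ℕ → State → State
    extend : State → ℕ → Bool → State

-- ⟨r₁,…,r_n⟩ as a term (n = 1 gives the variable r₁ itself)
qtup : ℕ → List ℕ → Term
qtup r []       = qv r
qtup r (s ∷ rs) = tup (qv r) (qv s) (map qv rs)

bitTerm : Bool → Term
bitTerm false = c0
bitTerm true  = c1

data PBinder : Set where
  bV : PBinder
  bT : ℕ → PBinder

lamπ : PBinder → Term → Term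
lamπ bV     M = ƛv M
lamπ (bT n) M = ƛt n M

module Reduction (𝓜 : QModel) where
  open QModel 𝓜

  record Conf : Set where
    constructor ⟪_,_,_⟫
    field
      st : State
      qs : List ℕ
      tm : Term

  WFConf : Conf → Set
  WFConf ⟪ Q , V , M ⟫ =
    Unique V × (∀ r → r ∈ Qv M → r ∈ V) × Σ Env λ Γ → ValidEnv Γ × (Γ ⊢ M)

  infix 2 _⟶ᵣ_

  data _⟶ᵣ_ : Conf → Conf → Set where
    Uq   : ∀ {Q V} i r rs → suc (length rs) ≡ arity i →
           ⟪ Q , V , U i · qtup r rs ⟫ ⟶ᵣ ⟪ applyU i (r ∷ rs) Q , V , qtup r rs ⟫
    newR : ∀ {Q V} c r → r ∉ V →
           ⟪ Q , V , new (bitTerm c) ⟫ ⟶ᵣ ⟪ extend Q r c , r ∷ V , qv r ⟫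
    lβ   : ∀ {Q V M N} → ⟪ Q , V , ƛv M · N ⟫ ⟶ᵣ ⟪ Q , V , open0 (N ∷ []) M ⟫
    qβ   : ∀ {Q V M} r₁ r₂ rs →
           ⟪ Q , V , ƛt (length rs) M · tup (qv r₁) (qv r₂) (map qv rs) ⟫ ⟶ᵣ
           ⟪ Q , V , open0 (map qv (r₁ ∷ r₂ ∷ rs)) M ⟫
    cβ   : ∀ {Q V M N} → ⟪ Q , V , ƛ! M · (! N) ⟫ ⟶ᵣ ⟪ Q , V , open0 (N ∷ []) M ⟫
    lcm  : ∀ {Q V L M N} b →
           ⟪ Q , V , L · (lamπ b M · N) ⟫ ⟶ᵣ ⟪ Q , V , lamπ b (L · M) · N ⟫
    rcm  : ∀ {Q V L M N} b →
           ⟪ Q , V , (lamπ b M · N) · L ⟫ ⟶ᵣ ⟪ Q , V , lamπ b (M · L) · N ⟫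
    tup₁ : ∀ {Q V Q' V' M M' N Ms} → ⟪ Q , V , M ⟫ ⟶ᵣ ⟪ Q' , V' , M' ⟫ →
           ⟪ Q , V , tup M N Ms ⟫ ⟶ᵣ ⟪ Q' , V' , tup M' N Ms ⟫
    tup₂ : ∀ {Q V Q' V' M N N' Ms} → ⟪ Q , V , N ⟫ ⟶ᵣ ⟪ Q' , V' , N' ⟫ →
           ⟪ Q , V , tup M N Ms ⟫ ⟶ᵣ ⟪ Q' , V' , tup M N' Ms ⟫
    tupₙ : ∀ {Q V Q' V' M N As K K' Bs} → ⟪ Q , V , K ⟫ ⟶ᵣ ⟪ Q' , V' , K' ⟫ →
           ⟪ Q , V , tup M N (As ++ K ∷ Bs) ⟫ ⟶ᵣ ⟪ Q' , V' , tup M N (As ++ K' ∷ Bs) ⟫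
    appL : ∀ {Q V Q' V' M M' N} → ⟪ Q , V , M ⟫ ⟶ᵣ ⟪ Q' , V' , M' ⟫ →
           ⟪ Q , V , M · N ⟫ ⟶ᵣ ⟪ Q' , V' , M' · N ⟫
    appR : ∀ {Q V Q' V' M N N'} → ⟪ Q , V , N ⟫ ⟶ᵣ ⟪ Q' , V' , N' ⟫ →
           ⟪ Q , V , M · N ⟫ ⟶ᵣ ⟪ Q' , V' , M · N' ⟫
    -- closure: body of λπ (locally nameless: open with distinct fresh names)
    lamVR : ∀ {Q V Q' V' M M'} x → x ∉ fv M → x ∉ fv M' →
            ⟪ Q , V , open0 (var x ∷ []) M ⟫ ⟶ᵣ ⟪ Q' , V' , open0 (var x ∷ []) M' ⟫ →
            ⟪ Q , V , ƛv M ⟫ ⟶ᵣ ⟪ Q' , V' , ƛv M' ⟫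
    lamTR : ∀ {Q V Q' V' M M'} x y xs → Unique (x ∷ y ∷ xs) →
            All (λ z → z ∉ fv M × z ∉ fv M') (x ∷ y ∷ xs) →
            ⟪ Q , V , open0 (map var (x ∷ y ∷ xs)) M ⟫ ⟶ᵣ ⟪ Q' , V' , open0 (map var (x ∷ y ∷ xs)) M' ⟫ →
            ⟪ Q , V , ƛt (length xs) M ⟫ ⟶ᵣ ⟪ Q' , V' , ƛt (length xs) M' ⟫

  infix 2 _⟶_ _⟶*_
  _⟶_ : Conf → Conf → Set
  C ⟶ D = WFConf C × (C ⟶ᵣ D)

  _⟶*_ : Conf → Conf → Set
  _⟶*_ = Star _⟶_

{-# OPTIONS --safe #-}
-- The rules of Γ ⊢ M are not syntax directed: weakening, contraction, dereliction and exchange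
-- apply anywhere, so a derivation cannot be inverted at a redex. The judgement is therefore first
-- translated into Θ ∣ Λ ⊩ M, in which the unrestricted names Θ are shared by all premises, the
-- linear environment Λ is split among them, binders quantify cofinitely over their names and
-- exchange is the only structural rule. There weakening, dereliction and substitution (linear
-- for λx and λ⟨x₁,…,xₙ⟩, unrestricted for λ!x) are admissible, which yields subject reduction:
-- a step leaves Λ unchanged, except that new(c) adds the qubit it creates. To return from ⊩ to ⊢,
-- every shared unrestricted name is renamed apart in each premise (⊢ is equivariant under
-- transpositions), the rule is applied, and the copies are contracted back.
module Submission where

open import Defs
open import Data.Bool using (false; true)
open import Data.Empty using (⊥-elim)
open import Data.Nat using (ℕ; zero; suc; _≟_; _<_; _≤_; z≤n; s≤s)
open import Data.Nat.ListAction using (sum)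
open import Data.Nat.Properties
  using (≤-trans; <-irrefl; <-≤-trans; n<1+n; m<n⇒m<1+n; m≤m+n; m≤n+m; suc-injective)
open import Data.List using (List; []; _∷_; _++_; map; length; concat; concatMap; filter; zipWith)
open import Data.List.Properties
  using (map-++; concatMap-++; ++-assoc; ++-identityʳ; length-map; map-id; map-∘; concat-map)
open import Data.List.Membership.Propositional using (_∈_; _∉_)
open import Data.List.Membership.Propositional.Properties
  using (∈-++⁺ˡ; ∈-++⁺ʳ; ∈-++⁻; ∈-map⁻; ∈-∃++; ∈-concat⁺′; ∈-filter⁺; ∈-filter⁻)
open import Data.List.Membership.DecPropositional _≟_ using (_∉?_)
open import Data.List.Relation.Unary.Any using (here; there)
open import Data.List.Relation.Unary.All as All using (All; []; _∷_)
open import Data.List.Relation.Unary.All.Properties as AllP using (¬Any⇒All¬; All¬⇒¬Any)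
open import Data.List.Relation.Unary.AllPairs using ([]; _∷_)
open import Data.List.Relation.Unary.Unique.Propositional using (Unique)
open import Data.List.Relation.Unary.Unique.Propositional.Properties as Unique using ()
open import Data.List.Relation.Binary.Pointwise using (Pointwise; []; _∷_; Pointwise-length)
open import Data.List.Relation.Binary.Subset.Propositional using (_⊆_)
open import Data.List.Relation.Binary.Subset.Propositional.Properties
  using (∷⁺ʳ; ⊆-refl; xs⊆x∷xs; xs⊆xs++ys; xs⊆ys++xs)
open import Data.List.Relation.Binary.Permutation.Propositional as Perm
  using (_↭_; ↭-refl; ↭-prep; ↭-trans; ↭-sym; ↭-reflexive; ↭⇒↭ₛ; module PermutationReasoning)
open import Data.List.Relation.Binary.Permutation.Propositional.Properties
  using (∈-resp-↭; ++⁺; ++⁺ˡ; ++⁺ʳ; shift; shifts; ++-comm; ↭-singleton-inv; drop-∷; ¬x∷xs↭[]; map⁺)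
open import Data.Unit using (⊤; tt)
open import Data.Product using (_×_; ∃; _,_; proj₁; proj₂)
open import Data.Sum as Sum using (_⊎_; inj₁; inj₂)
open import Function using (_∘_)
open import Function.Definitions using (Injective)
open import Relation.Binary.Construct.Closure.ReflexiveTransitive using (ε; _◅_)
open import Relation.Nullary using (yes; no)
open import Relation.Binary.PropositionalEquality
  using (_≡_; _≢_; refl; sym; trans; cong; cong₂; subst; subst₂; setoid; module ≡-Reasoning)
import Data.List.Relation.Binary.Permutation.Setoid.Properties (setoid ℕ) as PermS

cong₃ : ∀ {A B C D : Set} (f : A → B → C → D) {a a′ b b′ c c′} →
        a ≡ a′ → b ≡ b′ → c ≡ c′ → f a b c ≡ f a′ b′ c′
cong₃ f refl refl refl = refl

∉-++⁻ˡ : ∀ {A : Set} {x : A} {xs ys} → x ∉ xs ++ ys → x ∉ xs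
∉-++⁻ˡ x∉ p = x∉ (∈-++⁺ˡ p)

∉-++⁻ʳ : ∀ {A : Set} {x : A} xs {ys} → x ∉ xs ++ ys → x ∉ ys
∉-++⁻ʳ xs x∉ p = x∉ (∈-++⁺ʳ xs p)

∉-++⁺ : ∀ {A : Set} {x : A} xs {ys} → x ∉ xs → x ∉ ys → x ∉ xs ++ ys
∉-++⁺ xs x∉xs x∉ys p = Sum.[ x∉xs , x∉ys ] (∈-++⁻ xs p)

All∉-sym : ∀ {A : Set} {xs ys : List A} → All (_∉ ys) xs → All (_∉ xs) ys
All∉-sym xs∉ys = All.tabulate (λ y∈ys y∈xs → All.lookup xs∉ys y∈xs y∈ys)

All∉-∷⇒∉ : ∀ {A : Set} {x : A} {L ys} → All (_∉ x ∷ L) ys → x ∉ ys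
All∉-∷⇒∉ ys∉ = All.lookup (All∉-sym ys∉) (here refl)

↭-∷-split : ∀ {A : Set} {a : A} Λ₁ Λ₂ {Λ₀} → Λ₁ ++ Λ₂ ↭ a ∷ Λ₀ →
            (∃ λ B → Λ₁ ↭ a ∷ B × Λ₀ ↭ B ++ Λ₂) ⊎ (∃ λ B → Λ₂ ↭ a ∷ B × Λ₀ ↭ Λ₁ ++ B)
↭-∷-split {a = a} Λ₁ Λ₂ {Λ₀} π with ∈-++⁻ Λ₁ (∈-resp-↭ (↭-sym π) (here refl))
... | inj₁ a∈Λ₁ with B , C , refl ← ∈-∃++ a∈Λ₁ = inj₁ (B ++ C , shift a B C , drop-∷ (begin
  a ∷ Λ₀              ↭⟨ π ⟨
  (B ++ a ∷ C) ++ Λ₂  ≡⟨ ++-assoc B (a ∷ C) Λ₂ ⟩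
  B ++ a ∷ C ++ Λ₂    ↭⟨ shift a B (C ++ Λ₂) ⟩
  a ∷ B ++ C ++ Λ₂    ≡⟨ cong (a ∷_) (++-assoc B C Λ₂) ⟨
  a ∷ (B ++ C) ++ Λ₂  ∎))
  where open PermutationReasoning
... | inj₂ a∈Λ₂ with B , C , refl ← ∈-∃++ a∈Λ₂ = inj₂ (B ++ C , shift a B C , drop-∷ (begin
  a ∷ Λ₀              ↭⟨ π ⟨
  Λ₁ ++ B ++ a ∷ C    ↭⟨ ++⁺ˡ Λ₁ (shift a B C) ⟩
  Λ₁ ++ a ∷ B ++ C    ↭⟨ shift a Λ₁ (B ++ C) ⟩
  a ∷ Λ₁ ++ B ++ C    ∎))
  where open PermutationReasoning

mutual
  substVars : (ℕ → Term) → Term → Term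
  substVars σ (var x)      = σ x
  substVars σ (bv i j)     = bv i j
  substVars σ (qv r)       = qv r
  substVars σ (! M)        = ! substVars σ M
  substVars σ c0           = c0
  substVars σ c1           = c1
  substVars σ (U i)        = U i
  substVars σ (new M)      = new (substVars σ M)
  substVars σ (M · N)      = substVars σ M · substVars σ N
  substVars σ (tup M N Ms) = tup (substVars σ M) (substVars σ N) (substVarsL σ Ms)
  substVars σ (ƛ! M)       = ƛ! (substVars σ M)
  substVars σ (ƛv M)       = ƛv (substVars σ M)
  substVars σ (ƛt n M)     = ƛt n (substVars σ M)

  substVarsL : (ℕ → Term) → List Term → List Term
  substVarsL σ []       = []
  substVarsL σ (M ∷ Ms) = substVars σ M ∷ substVarsL σ Ms

infix 6 _↦_

_↦_ : ℕ → Term → ℕ → Term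
(x ↦ N) y with y ≟ x
... | yes _ = N
... | no  _ = var y

↦-same : ∀ x N → (x ↦ N) x ≡ N
↦-same x N with x ≟ x
... | yes _ = refl
... | no x≢x = ⊥-elim (x≢x refl)

↦-other : ∀ {x y} N → y ≢ x → (x ↦ N) y ≡ var y
↦-other {x} {y} N y≢x with y ≟ x
... | yes y≡x = ⊥-elim (y≢x y≡x)
... | no  _   = refl

mutual
  ren≡substVars : ∀ x z M → ren x z M ≡ substVars (x ↦ var z) M
  ren≡substVars x z (var y) with y ≟ x
  ... | yes _ = refl
  ... | no  _ = refl
  ren≡substVars x z (bv i j)     = refl
  ren≡substVars x z (qv r)       = refl
  ren≡substVars x z (! M)        = cong !_ (ren≡substVars x z M)
  ren≡substVars x z c0           = refl
  ren≡substVars x z c1           = refl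
  ren≡substVars x z (U i)        = refl
  ren≡substVars x z (new M)      = cong new (ren≡substVars x z M)
  ren≡substVars x z (M · N)      = cong₂ _·_ (ren≡substVars x z M) (ren≡substVars x z N)
  ren≡substVars x z (tup M N Ms) =
    cong₃ tup (ren≡substVars x z M) (ren≡substVars x z N) (renL≡substVarsL x z Ms)
  ren≡substVars x z (ƛ! M)       = cong ƛ! (ren≡substVars x z M)
  ren≡substVars x z (ƛv M)       = cong ƛv (ren≡substVars x z M)
  ren≡substVars x z (ƛt n M)     = cong (ƛt n) (ren≡substVars x z M)

  renL≡substVarsL : ∀ x z Ms → renL x z Ms ≡ substVarsL (x ↦ var z) Ms
  renL≡substVarsL x z []       = refl
  renL≡substVarsL x z (M ∷ Ms) = cong₂ _∷_ (ren≡substVars x z M) (renL≡substVarsL x z Ms)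

mutual
  substVars-cong : ∀ {σ τ} M → (∀ {y} → y ∈ fv M → σ y ≡ τ y) → substVars σ M ≡ substVars τ M
  substVars-cong (var x)      h = h (here refl)
  substVars-cong (bv i j)     h = refl
  substVars-cong (qv r)       h = refl
  substVars-cong (! M)        h = cong !_ (substVars-cong M h)
  substVars-cong c0           h = refl
  substVars-cong c1           h = refl
  substVars-cong (U i)        h = refl
  substVars-cong (new M)      h = cong new (substVars-cong M h)
  substVars-cong (M · N)      h =
    cong₂ _·_ (substVars-cong M (λ p → h (∈-++⁺ˡ p))) (substVars-cong N (λ p → h (∈-++⁺ʳ (fv M) p)))
  substVars-cong (tup M N Ms) h =
    cong₃ tup (substVars-cong M (λ p → h (∈-++⁺ˡ p)))
              (substVars-cong N (λ p → h (∈-++⁺ʳ (fv M) (∈-++⁺ˡ p))))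
              (substVarsL-cong Ms (λ p → h (∈-++⁺ʳ (fv M) (∈-++⁺ʳ (fv N) p))))
  substVars-cong (ƛ! M)       h = cong ƛ! (substVars-cong M h)
  substVars-cong (ƛv M)       h = cong ƛv (substVars-cong M h)
  substVars-cong (ƛt n M)     h = cong (ƛt n) (substVars-cong M h)

  substVarsL-cong : ∀ {σ τ} Ms → (∀ {y} → y ∈ fvL Ms → σ y ≡ τ y) → substVarsL σ Ms ≡ substVarsL τ Ms
  substVarsL-cong []       h = refl
  substVarsL-cong (M ∷ Ms) h =
    cong₂ _∷_ (substVars-cong M (λ p → h (∈-++⁺ˡ p))) (substVarsL-cong Ms (λ p → h (∈-++⁺ʳ (fv M) p)))

mutual
  substVars-var : ∀ M → substVars var M ≡ M
  substVars-var (var x)      = refl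
  substVars-var (bv i j)     = refl
  substVars-var (qv r)       = refl
  substVars-var (! M)        = cong !_ (substVars-var M)
  substVars-var c0           = refl
  substVars-var c1           = refl
  substVars-var (U i)        = refl
  substVars-var (new M)      = cong new (substVars-var M)
  substVars-var (M · N)      = cong₂ _·_ (substVars-var M) (substVars-var N)
  substVars-var (tup M N Ms) = cong₃ tup (substVars-var M) (substVars-var N) (substVarsL-var Ms)
  substVars-var (ƛ! M)       = cong ƛ! (substVars-var M)
  substVars-var (ƛv M)       = cong ƛv (substVars-var M)
  substVars-var (ƛt n M)     = cong (ƛt n) (substVars-var M)

  substVarsL-var : ∀ Ms → substVarsL var Ms ≡ Ms
  substVarsL-var []       = refl
  substVarsL-var (M ∷ Ms) = cong₂ _∷_ (substVars-var M) (substVarsL-var Ms)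

mutual
  substVars-∘ : ∀ σ τ M → substVars σ (substVars τ M) ≡ substVars (substVars σ ∘ τ) M
  substVars-∘ σ τ (var x)      = refl
  substVars-∘ σ τ (bv i j)     = refl
  substVars-∘ σ τ (qv r)       = refl
  substVars-∘ σ τ (! M)        = cong !_ (substVars-∘ σ τ M)
  substVars-∘ σ τ c0           = refl
  substVars-∘ σ τ c1           = refl
  substVars-∘ σ τ (U i)        = refl
  substVars-∘ σ τ (new M)      = cong new (substVars-∘ σ τ M)
  substVars-∘ σ τ (M · N)      = cong₂ _·_ (substVars-∘ σ τ M) (substVars-∘ σ τ N)
  substVars-∘ σ τ (tup M N Ms) = cong₃ tup (substVars-∘ σ τ M) (substVars-∘ σ τ N) (substVarsL-∘ σ τ Ms)
  substVars-∘ σ τ (ƛ! M)       = cong ƛ! (substVars-∘ σ τ M)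
  substVars-∘ σ τ (ƛv M)       = cong ƛv (substVars-∘ σ τ M)
  substVars-∘ σ τ (ƛt n M)     = cong (ƛt n) (substVars-∘ σ τ M)

  substVarsL-∘ : ∀ σ τ Ms → substVarsL σ (substVarsL τ Ms) ≡ substVarsL (substVars σ ∘ τ) Ms
  substVarsL-∘ σ τ []       = refl
  substVarsL-∘ σ τ (M ∷ Ms) = cong₂ _∷_ (substVars-∘ σ τ M) (substVarsL-∘ σ τ Ms)

mutual
  ∈-fv-substVars⁻ : ∀ {x} σ M → x ∈ fv (substVars σ M) → ∃ λ y → y ∈ fv M × x ∈ fv (σ y)
  ∈-fv-substVars⁻ σ (var y) p = y , here refl , p
  ∈-fv-substVars⁻ σ (! M)   p = ∈-fv-substVars⁻ σ M p
  ∈-fv-substVars⁻ σ (new M) p = ∈-fv-substVars⁻ σ M p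
  ∈-fv-substVars⁻ σ (M · N) p with ∈-++⁻ (fv (substVars σ M)) p
  ... | inj₁ q with y , y∈ , x∈ ← ∈-fv-substVars⁻ σ M q = y , ∈-++⁺ˡ y∈ , x∈
  ... | inj₂ q with y , y∈ , x∈ ← ∈-fv-substVars⁻ σ N q = y , ∈-++⁺ʳ (fv M) y∈ , x∈
  ∈-fv-substVars⁻ σ (tup M N Ms) p with ∈-++⁻ (fv (substVars σ M)) p
  ... | inj₁ q with y , y∈ , x∈ ← ∈-fv-substVars⁻ σ M q = y , ∈-++⁺ˡ y∈ , x∈
  ... | inj₂ q with ∈-++⁻ (fv (substVars σ N)) q
  ...   | inj₁ r with y , y∈ , x∈ ← ∈-fv-substVars⁻ σ N r = y , ∈-++⁺ʳ (fv M) (∈-++⁺ˡ y∈) , x∈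
  ...   | inj₂ r with y , y∈ , x∈ ← ∈-fv-substVarsL⁻ σ Ms r = y , ∈-++⁺ʳ (fv M) (∈-++⁺ʳ (fv N) y∈) , x∈
  ∈-fv-substVars⁻ σ (ƛ! M)   p = ∈-fv-substVars⁻ σ M p
  ∈-fv-substVars⁻ σ (ƛv M)   p = ∈-fv-substVars⁻ σ M p
  ∈-fv-substVars⁻ σ (ƛt n M) p = ∈-fv-substVars⁻ σ M p

  ∈-fv-substVarsL⁻ : ∀ {x} σ Ms → x ∈ fvL (substVarsL σ Ms) → ∃ λ y → y ∈ fvL Ms × x ∈ fv (σ y)
  ∈-fv-substVarsL⁻ σ (M ∷ Ms) p with ∈-++⁻ (fv (substVars σ M)) p
  ... | inj₁ q with y , y∈ , x∈ ← ∈-fv-substVars⁻ σ M q = y , ∈-++⁺ˡ y∈ , x∈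
  ... | inj₂ q with y , y∈ , x∈ ← ∈-fv-substVarsL⁻ σ Ms q = y , ∈-++⁺ʳ (fv M) y∈ , x∈

substVars-fresh : ∀ {x} N M → x ∉ fv M → substVars (x ↦ N) M ≡ M
substVars-fresh N M x∉M =
  trans (substVars-cong M (λ y∈M → ↦-other N (λ { refl → x∉M y∈M }))) (substVars-var M)

substVarsL-fresh : ∀ {x} N Ms → x ∉ fvL Ms → substVarsL (x ↦ N) Ms ≡ Ms
substVarsL-fresh N Ms x∉Ms =
  trans (substVarsL-cong Ms (λ y∈Ms → ↦-other N (λ { refl → x∉Ms y∈Ms }))) (substVarsL-var Ms)

ren-fresh : ∀ {x} z M → x ∉ fv M → ren x z M ≡ M
ren-fresh z M x∉M = trans (ren≡substVars _ z M) (substVars-fresh (var z) M x∉M)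

substVars-↦-self : ∀ x M → substVars (x ↦ var x) M ≡ M
substVars-↦-self x M = trans (substVars-cong M x↦x) (substVars-var M)
  where
  x↦x : ∀ {y} → y ∈ fv M → (x ↦ var x) y ≡ var y
  x↦x {y} _ with y ≟ x
  ... | yes refl = refl
  ... | no  _    = refl

ren-self : ∀ x M → ren x x M ≡ M
ren-self x M = trans (ren≡substVars x x M) (substVars-↦-self x M)

mutual
  lc : ℕ → Term → Set
  lc d (var x)      = ⊤
  lc d (bv i j)     = i < d
  lc d (qv r)       = ⊤
  lc d (! M)        = lc d M
  lc d c0           = ⊤
  lc d c1           = ⊤
  lc d (U i)        = ⊤
  lc d (new M)      = lc d M
  lc d (M · N)      = lc d M × lc d N
  lc d (tup M N Ms) = lc d M × lc d N × lcL d Ms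
  lc d (ƛ! M)       = lc (suc d) M
  lc d (ƛv M)       = lc (suc d) M
  lc d (ƛt n M)     = lc (suc d) M

  lcL : ℕ → List Term → Set
  lcL d []       = ⊤
  lcL d (M ∷ Ms) = lc d M × lcL d Ms

mutual
  inst-lc≤ : ∀ {d k} us M → lc d M → d ≤ k → inst k us M ≡ M
  inst-lc≤ {k = k} us (bv i j) i<d d≤k with i ≟ k
  ... | yes refl = ⊥-elim (<-irrefl refl (<-≤-trans i<d d≤k))
  ... | no  _    = refl
  inst-lc≤ us (var x)      _ _ = refl
  inst-lc≤ us (qv r)       _ _ = refl
  inst-lc≤ us (! M)        h le = cong !_ (inst-lc≤ us M h le)
  inst-lc≤ us c0           _ _ = refl
  inst-lc≤ us c1           _ _ = refl
  inst-lc≤ us (U i)        _ _ = refl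
  inst-lc≤ us (new M)      h le = cong new (inst-lc≤ us M h le)
  inst-lc≤ us (M · N) (hM , hN) le = cong₂ _·_ (inst-lc≤ us M hM le) (inst-lc≤ us N hN le)
  inst-lc≤ us (tup M N Ms) (hM , hN , hMs) le =
    cong₃ tup (inst-lc≤ us M hM le) (inst-lc≤ us N hN le) (instL-lc≤ us Ms hMs le)
  inst-lc≤ us (ƛ! M)       h le = cong ƛ! (inst-lc≤ us M h (s≤s le))
  inst-lc≤ us (ƛv M)       h le = cong ƛv (inst-lc≤ us M h (s≤s le))
  inst-lc≤ us (ƛt n M)     h le = cong (ƛt n) (inst-lc≤ us M h (s≤s le))

  instL-lc≤ : ∀ {d k} us Ms → lcL d Ms → d ≤ k → instL k us Ms ≡ Ms
  instL-lc≤ us []       _ _ = refl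
  instL-lc≤ us (M ∷ Ms) (hM , hMs) le = cong₂ _∷_ (inst-lc≤ us M hM le) (instL-lc≤ us Ms hMs le)

inst-lc : ∀ k us M → lc 0 M → inst k us M ≡ M
inst-lc k us M h = inst-lc≤ us M h z≤n

mutual
  lc-inst⁻ : ∀ d us M → lc d (inst d us M) → lc (suc d) M
  lc-inst⁻ d us (bv i j) h with i ≟ d
  ... | yes refl = n<1+n i
  ... | no  _    = m<n⇒m<1+n h
  lc-inst⁻ d us (var x)      _ = tt
  lc-inst⁻ d us (qv r)       _ = tt
  lc-inst⁻ d us (! M)        h = lc-inst⁻ d us M h
  lc-inst⁻ d us c0           _ = tt
  lc-inst⁻ d us c1           _ = tt
  lc-inst⁻ d us (U i)        _ = tt
  lc-inst⁻ d us (new M)      h = lc-inst⁻ d us M h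
  lc-inst⁻ d us (M · N) (hM , hN) = lc-inst⁻ d us M hM , lc-inst⁻ d us N hN
  lc-inst⁻ d us (tup M N Ms) (hM , hN , hMs) = lc-inst⁻ d us M hM , lc-inst⁻ d us N hN , lcL-inst⁻ d us Ms hMs
  lc-inst⁻ d us (ƛ! M)       h = lc-inst⁻ (suc d) us M h
  lc-inst⁻ d us (ƛv M)       h = lc-inst⁻ (suc d) us M h
  lc-inst⁻ d us (ƛt n M)     h = lc-inst⁻ (suc d) us M h

  lcL-inst⁻ : ∀ d us Ms → lcL d (instL d us Ms) → lcL (suc d) Ms
  lcL-inst⁻ d us []       _ = tt
  lcL-inst⁻ d us (M ∷ Ms) (hM , hMs) = lc-inst⁻ d us M hM , lcL-inst⁻ d us Ms hMs

pick-map : ∀ (f : Term → Term) us j d → f (pick us j d) ≡ pick (map f us) j (f d)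
pick-map f []       j       d = refl
pick-map f (u ∷ us) zero    d = refl
pick-map f (u ∷ us) (suc j) d = pick-map f us j d

mutual
  substVars-inst : ∀ {σ} → (∀ y → lc 0 (σ y)) → ∀ k us M →
                   substVars σ (inst k us M) ≡ inst k (map (substVars σ) us) (substVars σ M)
  substVars-inst {σ} lcσ k us (var y) = sym (inst-lc k _ (σ y) (lcσ y))
  substVars-inst {σ} lcσ k us (bv i j) with i ≟ k
  ... | yes _ = pick-map (substVars σ) us j (bv i j)
  ... | no  _ = refl
  substVars-inst lcσ k us (qv r)       = refl
  substVars-inst lcσ k us (! M)        = cong !_ (substVars-inst lcσ k us M)
  substVars-inst lcσ k us c0           = refl
  substVars-inst lcσ k us c1           = refl
  substVars-inst lcσ k us (U i)        = refl
  substVars-inst lcσ k us (new M)      = cong new (substVars-inst lcσ k us M)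
  substVars-inst lcσ k us (M · N)      = cong₂ _·_ (substVars-inst lcσ k us M) (substVars-inst lcσ k us N)
  substVars-inst lcσ k us (tup M N Ms) =
    cong₃ tup (substVars-inst lcσ k us M) (substVars-inst lcσ k us N) (substVarsL-inst lcσ k us Ms)
  substVars-inst lcσ k us (ƛ! M)       = cong ƛ! (substVars-inst lcσ (suc k) us M)
  substVars-inst lcσ k us (ƛv M)       = cong ƛv (substVars-inst lcσ (suc k) us M)
  substVars-inst lcσ k us (ƛt n M)     = cong (ƛt n) (substVars-inst lcσ (suc k) us M)

  substVarsL-inst : ∀ {σ} → (∀ y → lc 0 (σ y)) → ∀ k us Ms →
                    substVarsL σ (instL k us Ms) ≡ instL k (map (substVars σ) us) (substVarsL σ Ms)
  substVarsL-inst lcσ k us []       = refl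
  substVarsL-inst lcσ k us (M ∷ Ms) = cong₂ _∷_ (substVars-inst lcσ k us M) (substVarsL-inst lcσ k us Ms)

↦-lc : ∀ {x N} → lc 0 N → ∀ y → lc 0 ((x ↦ N) y)
↦-lc {x} lcN y with y ≟ x
... | yes _ = lcN
... | no  _ = tt

mutual
  fv-inst⁺ : ∀ {x} k us M → x ∈ fv M → x ∈ fv (inst k us M)
  fv-inst⁺ k us (var y)  p = p
  fv-inst⁺ k us (! M)    p = fv-inst⁺ k us M p
  fv-inst⁺ k us (new M)  p = fv-inst⁺ k us M p
  fv-inst⁺ k us (M · N)  p with ∈-++⁻ (fv M) p
  ... | inj₁ q = ∈-++⁺ˡ (fv-inst⁺ k us M q)
  ... | inj₂ q = ∈-++⁺ʳ (fv (inst k us M)) (fv-inst⁺ k us N q)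
  fv-inst⁺ k us (tup M N Ms) p with ∈-++⁻ (fv M) p
  ... | inj₁ q = ∈-++⁺ˡ (fv-inst⁺ k us M q)
  ... | inj₂ q with ∈-++⁻ (fv N) q
  ...   | inj₁ r = ∈-++⁺ʳ (fv (inst k us M)) (∈-++⁺ˡ (fv-inst⁺ k us N r))
  ...   | inj₂ r = ∈-++⁺ʳ (fv (inst k us M)) (∈-++⁺ʳ (fv (inst k us N)) (fvL-inst⁺ k us Ms r))
  fv-inst⁺ k us (ƛ! M)   p = fv-inst⁺ (suc k) us M p
  fv-inst⁺ k us (ƛv M)   p = fv-inst⁺ (suc k) us M p
  fv-inst⁺ k us (ƛt n M) p = fv-inst⁺ (suc k) us M p

  fvL-inst⁺ : ∀ {x} k us Ms → x ∈ fvL Ms → x ∈ fvL (instL k us Ms)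
  fvL-inst⁺ k us (M ∷ Ms) p with ∈-++⁻ (fv M) p
  ... | inj₁ q = ∈-++⁺ˡ (fv-inst⁺ k us M q)
  ... | inj₂ q = ∈-++⁺ʳ (fv (inst k us M)) (fvL-inst⁺ k us Ms q)

pick-fv : ∀ {x} us j d → x ∈ fv (pick us j d) → x ∈ fvL us ⊎ x ∈ fv d
pick-fv []       j       d p = inj₂ p
pick-fv (u ∷ us) zero    d p = inj₁ (∈-++⁺ˡ p)
pick-fv (u ∷ us) (suc j) d p = Sum.map₁ (∈-++⁺ʳ (fv u)) (pick-fv us j d p)

mutual
  fv-inst⁻ : ∀ {x} k us M → x ∈ fv (inst k us M) → x ∈ fv M ⊎ x ∈ fvL us
  fv-inst⁻ k us (var y) p = inj₁ p
  fv-inst⁻ k us (bv i j) p with i ≟ k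
  ... | yes _ = Sum.swap (pick-fv us j (bv i j) p)
  ... | no  _ = inj₁ p
  fv-inst⁻ k us (! M)   p = fv-inst⁻ k us M p
  fv-inst⁻ k us (new M) p = fv-inst⁻ k us M p
  fv-inst⁻ k us (M · N) p with ∈-++⁻ (fv (inst k us M)) p
  ... | inj₁ q = Sum.map₁ ∈-++⁺ˡ (fv-inst⁻ k us M q)
  ... | inj₂ q = Sum.map₁ (∈-++⁺ʳ (fv M)) (fv-inst⁻ k us N q)
  fv-inst⁻ k us (tup M N Ms) p with ∈-++⁻ (fv (inst k us M)) p
  ... | inj₁ q = Sum.map₁ ∈-++⁺ˡ (fv-inst⁻ k us M q)
  ... | inj₂ q with ∈-++⁻ (fv (inst k us N)) q
  ...   | inj₁ r = Sum.map₁ (∈-++⁺ʳ (fv M) ∘ ∈-++⁺ˡ) (fv-inst⁻ k us N r)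
  ...   | inj₂ r = Sum.map₁ (∈-++⁺ʳ (fv M) ∘ ∈-++⁺ʳ (fv N)) (fvL-inst⁻ k us Ms r)
  fv-inst⁻ k us (ƛ! M)   p = fv-inst⁻ (suc k) us M p
  fv-inst⁻ k us (ƛv M)   p = fv-inst⁻ (suc k) us M p
  fv-inst⁻ k us (ƛt n M) p = fv-inst⁻ (suc k) us M p

  fvL-inst⁻ : ∀ {x} k us Ms → x ∈ fvL (instL k us Ms) → x ∈ fvL Ms ⊎ x ∈ fvL us
  fvL-inst⁻ k us (M ∷ Ms) p with ∈-++⁻ (fv (inst k us M)) p
  ... | inj₁ q = Sum.map₁ ∈-++⁺ˡ (fv-inst⁻ k us M q)
  ... | inj₂ q = Sum.map₁ (∈-++⁺ʳ (fv M)) (fvL-inst⁻ k us Ms q)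

fvL-map-var : ∀ xs → fvL (map var xs) ≡ xs
fvL-map-var []       = refl
fvL-map-var (x ∷ xs) = cong (x ∷_) (fvL-map-var xs)

fv-open-vars⁻ : ∀ {x} xs M → x ∈ fv (open0 (map var xs) M) → x ∈ fv M ⊎ x ∈ xs
fv-open-vars⁻ {x} xs M p = Sum.map₂ (subst (x ∈_) (fvL-map-var xs)) (fv-inst⁻ 0 (map var xs) M p)

pick-Qv : ∀ us j d → All (λ u → Qv u ≡ []) us → Qv d ≡ [] → Qv (pick us j d) ≡ []
pick-Qv []       j       d _        hd = hd
pick-Qv (u ∷ us) zero    d (hu ∷ _) _  = hu
pick-Qv (u ∷ us) (suc j) d (_ ∷ hs) hd = pick-Qv us j d hs hd

mutual
  Qv-inst : ∀ k us M → All (λ u → Qv u ≡ []) us → Qv (inst k us M) ≡ Qv M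
  Qv-inst k us (bv i j) h with i ≟ k
  ... | yes _ = pick-Qv us j (bv i j) h refl
  ... | no  _ = refl
  Qv-inst k us (var y)      h = refl
  Qv-inst k us (qv r)       h = refl
  Qv-inst k us (! M)        h = Qv-inst k us M h
  Qv-inst k us c0           h = refl
  Qv-inst k us c1           h = refl
  Qv-inst k us (U i)        h = refl
  Qv-inst k us (new M)      h = Qv-inst k us M h
  Qv-inst k us (M · N)      h = cong₂ _++_ (Qv-inst k us M h) (Qv-inst k us N h)
  Qv-inst k us (tup M N Ms) h =
    cong₂ _++_ (Qv-inst k us M h) (cong₂ _++_ (Qv-inst k us N h) (QvL-inst k us Ms h))
  Qv-inst k us (ƛ! M)       h = Qv-inst (suc k) us M h
  Qv-inst k us (ƛv M)       h = Qv-inst (suc k) us M h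
  Qv-inst k us (ƛt n M)     h = Qv-inst (suc k) us M h

  QvL-inst : ∀ k us Ms → All (λ u → Qv u ≡ []) us → QvL (instL k us Ms) ≡ QvL Ms
  QvL-inst k us []       h = refl
  QvL-inst k us (M ∷ Ms) h = cong₂ _++_ (Qv-inst k us M h) (QvL-inst k us Ms h)

Qv-open-vars : ∀ xs M → Qv (open0 (map var xs) M) ≡ Qv M
Qv-open-vars xs M = Qv-inst 0 (map var xs) M (All.tabulate λ u∈ → qv-var (∈-map⁻ var u∈))
  where
  qv-var : ∀ {u} → ∃ (λ x → x ∈ xs × u ≡ var x) → Qv u ≡ []
  qv-var (_ , _ , refl) = refl

rename : (ℕ → ℕ) → Term → Term
rename ρ = substVars (var ∘ ρ)

rename-↦ : ∀ {ρ} → Injective _≡_ _≡_ ρ → ∀ x z y →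
           rename ρ ((x ↦ var z) y) ≡ (ρ x ↦ var (ρ z)) (ρ y)
rename-↦ {ρ} inj x z y with y ≟ x | ρ y ≟ ρ x
... | yes _    | yes _   = refl
... | yes refl | no ρy≢ρx = ⊥-elim (ρy≢ρx refl)
... | no y≢x   | yes ρy≡ρx = ⊥-elim (y≢x (inj ρy≡ρx))
... | no _     | no _    = refl

rename-ren : ∀ {ρ} → Injective _≡_ _≡_ ρ → ∀ x z M → rename ρ (ren x z M) ≡ ren (ρ x) (ρ z) (rename ρ M)
rename-ren {ρ} inj x z M = begin
  rename ρ (ren x z M)                                    ≡⟨ cong (rename ρ) (ren≡substVars x z M) ⟩
  rename ρ (substVars (x ↦ var z) M)                      ≡⟨ substVars-∘ _ _ M ⟩
  substVars (rename ρ ∘ (x ↦ var z)) M                    ≡⟨ substVars-cong M (λ {y} _ → rename-↦ inj x z y) ⟩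
  substVars ((ρ x ↦ var (ρ z)) ∘ ρ) M                     ≡⟨ substVars-∘ _ _ M ⟨
  substVars (ρ x ↦ var (ρ z)) (rename ρ M)                ≡⟨ ren≡substVars (ρ x) (ρ z) (rename ρ M) ⟨
  ren (ρ x) (ρ z) (rename ρ M)                            ∎
  where open ≡-Reasoning

rename-inst : ∀ ρ k us M → rename ρ (inst k us M) ≡ inst k (map (rename ρ) us) (rename ρ M)
rename-inst ρ = substVars-inst (λ _ → tt)

∉-fv-rename : ∀ {ρ} → Injective _≡_ _≡_ ρ → ∀ {x} M → x ∉ fv M → ρ x ∉ fv (rename ρ M)
∉-fv-rename {ρ} inj M x∉M p with ∈-fv-substVars⁻ (var ∘ ρ) M p
... | y , y∈M , here ρx≡ρy rewrite inj ρx≡ρy = x∉M y∈M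

transpose : ℕ → ℕ → ℕ → ℕ
transpose a b x with x ≟ a
... | yes _ = b
... | no  _ with x ≟ b
...   | yes _ = a
...   | no  _ = x

transpose-left : ∀ a b → transpose a b a ≡ b
transpose-left a b with a ≟ a
... | yes _   = refl
... | no a≢a  = ⊥-elim (a≢a refl)

transpose-right : ∀ a b → transpose a b b ≡ a
transpose-right a b with b ≟ a
... | yes b≡a = b≡a
... | no  _ with b ≟ b
...   | yes _   = refl
...   | no b≢b  = ⊥-elim (b≢b refl)

transpose-other : ∀ {a b x} → x ≢ a → x ≢ b → transpose a b x ≡ x
transpose-other {a} {b} {x} x≢a x≢b with x ≟ a
... | yes x≡a = ⊥-elim (x≢a x≡a)
... | no  _ with x ≟ b
...   | yes x≡b = ⊥-elim (x≢b x≡b)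
...   | no  _   = refl

transpose-involutive : ∀ a b x → transpose a b (transpose a b x) ≡ x
transpose-involutive a b x with x ≟ a
... | yes refl = transpose-right x b
... | no x≢a with x ≟ b
...   | yes refl = transpose-left a x
...   | no x≢b   = transpose-other x≢a x≢b

transpose-injective : ∀ a b → Injective _≡_ _≡_ (transpose a b)
transpose-injective a b {x} {y} eq = begin
  x                                   ≡⟨ transpose-involutive a b x ⟨
  transpose a b (transpose a b x)     ≡⟨ cong (transpose a b) eq ⟩
  transpose a b (transpose a b y)     ≡⟨ transpose-involutive a b y ⟩
  y                                   ∎
  where open ≡-Reasoning

ren-transpose : ∀ s t M → t ∉ fv M → ren t s (rename (transpose s t) M) ≡ M
ren-transpose s t M t∉M = begin
  ren t s (rename (transpose s t) M)                    ≡⟨ ren≡substVars t s (rename (transpose s t) M) ⟩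
  substVars (t ↦ var s) (rename (transpose s t) M)      ≡⟨ substVars-∘ _ _ M ⟩
  substVars (λ y → (t ↦ var s) (transpose s t y)) M     ≡⟨ substVars-cong M back ⟩
  substVars var M                                       ≡⟨ substVars-var M ⟩
  M                                                     ∎
  where
  open ≡-Reasoning
  back : ∀ {y} → y ∈ fv M → (t ↦ var s) (transpose s t y) ≡ var y
  back {y} y∈M with y ≟ s
  ... | yes refl = ↦-same t (var y)
  ... | no y≢s with y ≟ t
  ...   | yes refl = ⊥-elim (t∉M y∈M)
  ...   | no y≢t   = ↦-other (var s) y≢t

∈⇒≤sum : ∀ {x} xs → x ∈ xs → x ≤ sum xs
∈⇒≤sum (y ∷ ys) (here refl) = m≤m+n y (sum ys)
∈⇒≤sum (y ∷ ys) (there p)   = ≤-trans (∈⇒≤sum ys p) (m≤n+m (sum ys) y)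

fresh : List ℕ → ℕ
fresh xs = suc (sum xs)

fresh-∉ : ∀ xs → fresh xs ∉ xs
fresh-∉ xs p = <-irrefl refl (≤-trans (n<1+n (sum xs)) (∈⇒≤sum xs p))

freshs : ℕ → List ℕ → List ℕ
freshs zero    L = []
freshs (suc n) L = fresh L ∷ freshs n (fresh L ∷ L)

freshs-length : ∀ n L → length (freshs n L) ≡ n
freshs-length zero    L = refl
freshs-length (suc n) L = cong suc (freshs-length n (fresh L ∷ L))

freshs-∉ : ∀ n L → All (_∉ L) (freshs n L)
freshs-∉ zero    L = []
freshs-∉ (suc n) L = fresh-∉ L ∷ All.map (λ h p → h (there p)) (freshs-∉ n (fresh L ∷ L))

freshs-unique : ∀ n L → Unique (freshs n L)
freshs-unique zero    L = []
freshs-unique (suc n) L =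
  All.map (λ h eq → h (here (sym eq))) (freshs-∉ n (fresh L ∷ L)) ∷ freshs-unique n (fresh L ∷ L)

fresh-names : ∀ n (Ls : List (List ℕ)) →
              ∃ λ xs → length xs ≡ n × Unique xs × All (λ L → All (_∉ L) xs) Ls
fresh-names n Ls =
  freshs n (concat Ls) , freshs-length n _ , freshs-unique n _ ,
  All.tabulate (λ L∈Ls → All.map (λ h p → h (∈-concat⁺′ p L∈Ls)) (freshs-∉ n (concat Ls)))

fresh-name : ∀ (Ls : List (List ℕ)) → ∃ λ x → All (x ∉_) Ls
fresh-name Ls with _ ∷ [] , _ , _ , apart ← fresh-names 1 Ls = _ , All.map (λ { (h ∷ []) → h }) apart

module _ {A B : Set} (f : A → List B) where

  concatMap-↭ : ∀ {xs ys} → xs ↭ ys → concatMap f xs ↭ concatMap f ys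
  concatMap-↭ Perm.refl         = ↭-refl
  concatMap-↭ (Perm.prep x p)   = ++⁺ˡ (f x) (concatMap-↭ p)
  concatMap-↭ (Perm.swap x y p) = ↭-trans (shifts (f x) (f y)) (++⁺ˡ (f y) (++⁺ˡ (f x) (concatMap-↭ p)))
  concatMap-↭ (Perm.trans p q)  = ↭-trans (concatMap-↭ p) (concatMap-↭ q)

  ∈-concatMap-++⁻ : ∀ xs {ys z} → z ∈ concatMap f (xs ++ ys) → z ∈ concatMap f xs ⊎ z ∈ concatMap f ys
  ∈-concatMap-++⁻ xs {ys} p = ∈-++⁻ (concatMap f xs) (subst (_ ∈_) (concatMap-++ f xs ys) p)

  ∈-concatMap-++⁺ˡ : ∀ xs ys {z} → z ∈ concatMap f xs → z ∈ concatMap f (xs ++ ys)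
  ∈-concatMap-++⁺ˡ xs ys p = subst (_ ∈_) (sym (concatMap-++ f xs ys)) (∈-++⁺ˡ p)

  ∈-concatMap-++⁺ʳ : ∀ xs {ys z} → z ∈ concatMap f ys → z ∈ concatMap f (xs ++ ys)
  ∈-concatMap-++⁺ʳ xs {ys} p = subst (_ ∈_) (sym (concatMap-++ f xs ys)) (∈-++⁺ʳ (concatMap f xs) p)

  ∉-concatMap-↭ : ∀ {xs ys z} → xs ↭ ys → z ∉ concatMap f xs → z ∉ concatMap f ys
  ∉-concatMap-↭ π z∉ p = z∉ (∈-resp-↭ (concatMap-↭ (↭-sym π)) p)

  ∉-concatMap-++⁺ : ∀ xs ys {z} → z ∉ concatMap f xs → z ∉ concatMap f ys → z ∉ concatMap f (xs ++ ys)
  ∉-concatMap-++⁺ xs ys z∉xs z∉ys p = Sum.[ z∉xs , z∉ys ] (∈-concatMap-++⁻ xs p)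

  ∉-concatMap-++⁻ : ∀ xs ys {z} → z ∉ concatMap f (xs ++ ys) → z ∉ concatMap f xs × z ∉ concatMap f ys
  ∉-concatMap-++⁻ xs ys z∉ = (λ p → z∉ (∈-concatMap-++⁺ˡ xs ys p)) , (λ p → z∉ (∈-concatMap-++⁺ʳ xs p))

cvars : Env → List ℕ
cvars = concatMap cnames

qvars : Env → List ℕ
qvars = concatMap qnames

cvars-pvars : ∀ xs → cvars (pvars xs) ≡ xs
cvars-pvars []       = refl
cvars-pvars (x ∷ xs) = cong (x ∷_) (cvars-pvars xs)

∉-cvars-split : ∀ {x} Λ₁ Λ₂ {Λ₀} → x ∉ cvars Λ₀ → Λ₀ ↭ Λ₁ ++ Λ₂ → x ∉ cvars Λ₁ × x ∉ cvars Λ₂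
∉-cvars-split Λ₁ Λ₂ x∉ π = ∉-concatMap-++⁻ cnames Λ₁ Λ₂ (∉-concatMap-↭ cnames π x∉)

∉-cvars-pvars-++ : ∀ {x} ys Λ → x ∉ ys → x ∉ cvars Λ → x ∉ cvars (pvars ys ++ Λ)
∉-cvars-pvars-++ {x} ys Λ x∉ys x∉Λ =
  ∉-concatMap-++⁺ cnames (pvars ys) Λ (x∉ys ∘ subst (x ∈_) (cvars-pvars ys)) x∉Λ

qvars-pvars : ∀ xs → qvars (pvars xs) ≡ []
qvars-pvars []       = refl
qvars-pvars (x ∷ xs) = qvars-pvars xs

-- The syntax-directed judgement Θ ∣ Λ ⊩ M

-- Θ lists the names bound as !x; Λ holds the linear items, tuple patterns flattened into their
-- variables. A binder premise must hold for all choices of names outside a finite set L.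
infix 3 _∣_⊩_

data _∣_⊩_ : List ℕ → Env → Term → Set

_∣_⊩*_ : List ℕ → List Env → List Term → Set
Θ ∣ Λs ⊩* Ms = Pointwise (λ Λ M → Θ ∣ Λ ⊩ M) Λs Ms

LinearOpenings : List ℕ → Env → ℕ → Term → List ℕ → Set
LinearOpenings Θ Λ k M L =
  ∀ xs → length xs ≡ k → Unique xs → All (_∉ L) xs → Θ ∣ pvars xs ++ Λ ⊩ open0 (map var xs) M

data _∣_⊩_ where
  ⊩c0   : ∀ {Θ} → Θ ∣ [] ⊩ c0
  ⊩c1   : ∀ {Θ} → Θ ∣ [] ⊩ c1
  ⊩U    : ∀ {Θ} i → Θ ∣ [] ⊩ U i
  ⊩qv   : ∀ {Θ} r → Θ ∣ qit r ∷ [] ⊩ qv r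
  ⊩lin  : ∀ {Θ} x → Θ ∣ pat (pvar x) ∷ [] ⊩ var x
  ⊩unr  : ∀ {Θ} x → x ∈ Θ → Θ ∣ [] ⊩ var x
  ⊩!    : ∀ {Θ M} → Θ ∣ [] ⊩ M → Θ ∣ [] ⊩ ! M
  ⊩new  : ∀ {Θ Λ M} → Θ ∣ Λ ⊩ M → Θ ∣ Λ ⊩ new M
  ⊩app  : ∀ {Θ Λ₁ Λ₂ M N} → Θ ∣ Λ₁ ⊩ M → Θ ∣ Λ₂ ⊩ N → Θ ∣ Λ₁ ++ Λ₂ ⊩ M · N
  ⊩tup  : ∀ {Θ Λs M N Ms} → Θ ∣ Λs ⊩* (M ∷ N ∷ Ms) → Θ ∣ concat Λs ⊩ tup M N Ms
  ⊩ƛv   : ∀ {Θ Λ M} L → LinearOpenings Θ Λ 1 M L → Θ ∣ Λ ⊩ ƛv M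
  ⊩ƛt   : ∀ {Θ Λ M} n L → LinearOpenings Θ Λ (suc (suc n)) M L → Θ ∣ Λ ⊩ ƛt n M
  ⊩ƛ!   : ∀ {Θ Λ M} L → (∀ x → x ∉ L → x ∷ Θ ∣ Λ ⊩ open0 (var x ∷ []) M) → Θ ∣ Λ ⊩ ƛ! M
  ⊩exch : ∀ {Θ Λ Λ′ M} → Θ ∣ Λ ⊩ M → Λ ↭ Λ′ → Θ ∣ Λ′ ⊩ M

mutual
  ⊩-lc : ∀ {Θ Λ M} → Θ ∣ Λ ⊩ M → lc 0 M
  ⊩-lc ⊩c0                 = tt
  ⊩-lc ⊩c1                 = tt
  ⊩-lc (⊩U i)              = tt
  ⊩-lc (⊩qv r)             = tt
  ⊩-lc (⊩lin x)            = tt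
  ⊩-lc (⊩unr x _)          = tt
  ⊩-lc (⊩! d)              = ⊩-lc d
  ⊩-lc (⊩new d)            = ⊩-lc d
  ⊩-lc (⊩app d e)          = ⊩-lc d , ⊩-lc e
  ⊩-lc (⊩tup (d ∷ e ∷ ds)) = ⊩-lc d , ⊩-lc e , ⊩-lc* ds
  ⊩-lc (⊩ƛv {M = M} L f)   = ⊩-lc-openings {M = M} 1 L f
  ⊩-lc (⊩ƛt {M = M} n L f) = ⊩-lc-openings {M = M} (suc (suc n)) L f
  ⊩-lc (⊩ƛ! {M = M} L f) with x , x∉L ∷ [] ← fresh-name (L ∷ []) = lc-inst⁻ 0 _ M (⊩-lc (f x x∉L))
  ⊩-lc (⊩exch d _)         = ⊩-lc d

  ⊩-lc-openings : ∀ {Θ Λ M} k L → LinearOpenings Θ Λ k M L → lc 1 M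
  ⊩-lc-openings {M = M} k L f with xs , len , uniq , xs∉L ∷ [] ← fresh-names k (L ∷ []) =
    lc-inst⁻ 0 (map var xs) M (⊩-lc (f xs len uniq xs∉L))

  ⊩-lc* : ∀ {Θ Λs Ms} → Θ ∣ Λs ⊩* Ms → lcL 0 Ms
  ⊩-lc* []       = tt
  ⊩-lc* (d ∷ ds) = ⊩-lc d , ⊩-lc* ds

mutual
  ⊩-weaken : ∀ {Θ Θ′ Λ M} → Θ ⊆ Θ′ → Θ ∣ Λ ⊩ M → Θ′ ∣ Λ ⊩ M
  ⊩-weaken h ⊩c0         = ⊩c0
  ⊩-weaken h ⊩c1         = ⊩c1
  ⊩-weaken h (⊩U i)      = ⊩U i
  ⊩-weaken h (⊩qv r)     = ⊩qv r
  ⊩-weaken h (⊩lin x)    = ⊩lin x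
  ⊩-weaken h (⊩unr x p)  = ⊩unr x (h p)
  ⊩-weaken h (⊩! d)      = ⊩! (⊩-weaken h d)
  ⊩-weaken h (⊩new d)    = ⊩new (⊩-weaken h d)
  ⊩-weaken h (⊩app d e)  = ⊩app (⊩-weaken h d) (⊩-weaken h e)
  ⊩-weaken h (⊩tup ds)   = ⊩tup (⊩-weaken* h ds)
  ⊩-weaken h (⊩ƛv L f)   = ⊩ƛv L (λ xs len u a → ⊩-weaken h (f xs len u a))
  ⊩-weaken h (⊩ƛt n L f) = ⊩ƛt n L (λ xs len u a → ⊩-weaken h (f xs len u a))
  ⊩-weaken h (⊩ƛ! L f)   = ⊩ƛ! L (λ x x∉L → ⊩-weaken (∷⁺ʳ x h) (f x x∉L))
  ⊩-weaken h (⊩exch d π) = ⊩exch (⊩-weaken h d) π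

  ⊩-weaken* : ∀ {Θ Θ′ Λs Ms} → Θ ⊆ Θ′ → Θ ∣ Λs ⊩* Ms → Θ′ ∣ Λs ⊩* Ms
  ⊩-weaken* h []       = []
  ⊩-weaken* h (d ∷ ds) = ⊩-weaken h d ∷ ⊩-weaken* h ds

mutual
  ⊩-fv : ∀ {Θ Λ M x} → Θ ∣ Λ ⊩ M → x ∈ fv M → x ∈ Θ ⊎ x ∈ cvars Λ
  ⊩-fv (⊩lin x)   (here refl) = inj₂ (here refl)
  ⊩-fv (⊩unr x q) (here refl) = inj₁ q
  ⊩-fv (⊩! d)   p = ⊩-fv d p
  ⊩-fv (⊩new d) p = ⊩-fv d p
  ⊩-fv (⊩app {Λ₁ = Λ₁} {Λ₂} {M} d e) p with ∈-++⁻ (fv M) p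
  ... | inj₁ q = Sum.map₂ (∈-concatMap-++⁺ˡ cnames Λ₁ Λ₂) (⊩-fv d q)
  ... | inj₂ q = Sum.map₂ (∈-concatMap-++⁺ʳ cnames Λ₁) (⊩-fv e q)
  ⊩-fv (⊩tup ds) p = ⊩-fv* ds p
  ⊩-fv (⊩ƛv {M = M} L f)   p = ⊩-fv-openings {M = M} 1 L f p
  ⊩-fv (⊩ƛt {M = M} n L f) p = ⊩-fv-openings {M = M} (suc (suc n)) L f p
  ⊩-fv {x = x} (⊩ƛ! {M = M} L f) p
    with y , y∉L ∷ y∉x ∷ [] ← fresh-name (L ∷ (x ∷ []) ∷ [])
    with ⊩-fv (f y y∉L) (fv-inst⁺ 0 _ M p)
  ... | inj₁ (here refl) = ⊥-elim (y∉x (here refl))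
  ... | inj₁ (there x∈Θ) = inj₁ x∈Θ
  ... | inj₂ x∈Λ         = inj₂ x∈Λ
  ⊩-fv (⊩exch d π) p = Sum.map₂ (∈-resp-↭ (concatMap-↭ cnames π)) (⊩-fv d p)

  ⊩-fv-openings : ∀ {Θ Λ M x} k L → LinearOpenings Θ Λ k M L → x ∈ fv M → x ∈ Θ ⊎ x ∈ cvars Λ
  ⊩-fv-openings {M = M} {x} k L f p
    with xs , len , u , xs∉L ∷ xs∉x ∷ [] ← fresh-names k (L ∷ (x ∷ []) ∷ [])
    with ⊩-fv (f xs len u xs∉L) (fv-inst⁺ 0 _ M p)
  ... | inj₁ x∈Θ = inj₁ x∈Θ
  ... | inj₂ x∈Λ with ∈-concatMap-++⁻ cnames (pvars xs) x∈Λ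
  ...   | inj₂ q = inj₂ q
  ...   | inj₁ q = ⊥-elim (All.lookup xs∉x (subst (x ∈_) (cvars-pvars xs) q) (here refl))

  ⊩-fv* : ∀ {Θ Λs Ms x} → Θ ∣ Λs ⊩* Ms → x ∈ fvL Ms → x ∈ Θ ⊎ x ∈ cvars (concat Λs)
  ⊩-fv* {Λs = Λ ∷ Λs} {M ∷ Ms} (d ∷ ds) p with ∈-++⁻ (fv M) p
  ... | inj₁ q = Sum.map₂ (∈-concatMap-++⁺ˡ cnames Λ (concat Λs)) (⊩-fv d q)
  ... | inj₂ q = Sum.map₂ (∈-concatMap-++⁺ʳ cnames Λ) (⊩-fv* ds q)

⊩-∉fv : ∀ {Θ Λ M x} → Θ ∣ Λ ⊩ M → x ∉ Θ → x ∉ cvars Λ → x ∉ fv M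
⊩-∉fv d x∉Θ x∉Λ p = Sum.[ x∉Θ , x∉Λ ] (⊩-fv d p)

⊩-∉fv* : ∀ {Θ Λs Ms x} → Θ ∣ Λs ⊩* Ms → x ∉ Θ → x ∉ cvars (concat Λs) → x ∉ fvL Ms
⊩-∉fv* ds x∉Θ x∉Λs p = Sum.[ x∉Θ , x∉Λs ] (⊩-fv* ds p)

mutual
  ⊩-cvars : ∀ {Θ Λ M x} → Θ ∣ Λ ⊩ M → x ∈ cvars Λ → x ∈ fv M
  ⊩-cvars (⊩lin x) (here refl) = here refl
  ⊩-cvars (⊩new d) p = ⊩-cvars d p
  ⊩-cvars (⊩app {Λ₁ = Λ₁} {M = M} d e) p with ∈-concatMap-++⁻ cnames Λ₁ p
  ... | inj₁ q = ∈-++⁺ˡ (⊩-cvars d q)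
  ... | inj₂ q = ∈-++⁺ʳ (fv M) (⊩-cvars e q)
  ⊩-cvars (⊩tup ds) p = ⊩-cvars* ds p
  ⊩-cvars (⊩ƛv {M = M} L f)   p = ⊩-cvars-openings {M = M} 1 L f p
  ⊩-cvars (⊩ƛt {M = M} n L f) p = ⊩-cvars-openings {M = M} (suc (suc n)) L f p
  ⊩-cvars {x = x} (⊩ƛ! {M = M} L f) p
    with y , y∉L ∷ y∉x ∷ [] ← fresh-name (L ∷ (x ∷ []) ∷ [])
    with fv-open-vars⁻ (y ∷ []) M (⊩-cvars (f y y∉L) p)
  ... | inj₁ x∈M         = x∈M
  ... | inj₂ (here refl) = ⊥-elim (y∉x (here refl))
  ⊩-cvars (⊩exch d π) p = ⊩-cvars d (∈-resp-↭ (concatMap-↭ cnames (↭-sym π)) p)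

  ⊩-cvars-openings : ∀ {Θ Λ M x} k L → LinearOpenings Θ Λ k M L → x ∈ cvars Λ → x ∈ fv M
  ⊩-cvars-openings {M = M} {x} k L f p
    with xs , len , u , xs∉L ∷ xs∉x ∷ [] ← fresh-names k (L ∷ (x ∷ []) ∷ [])
    with fv-open-vars⁻ xs M (⊩-cvars (f xs len u xs∉L) (∈-concatMap-++⁺ʳ cnames (pvars xs) p))
  ... | inj₁ x∈M = x∈M
  ... | inj₂ x∈xs = ⊥-elim (All.lookup xs∉x x∈xs (here refl))

  ⊩-cvars* : ∀ {Θ Λs Ms x} → Θ ∣ Λs ⊩* Ms → x ∈ cvars (concat Λs) → x ∈ fvL Ms
  ⊩-cvars* {Λs = Λ ∷ Λs} {M ∷ Ms} (d ∷ ds) p with ∈-concatMap-++⁻ cnames Λ p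
  ... | inj₁ q = ∈-++⁺ˡ (⊩-cvars d q)
  ... | inj₂ q = ∈-++⁺ʳ (fv M) (⊩-cvars* ds q)

qvars-pvars-++ : ∀ xs Λ → qvars (pvars xs ++ Λ) ≡ qvars Λ
qvars-pvars-++ xs Λ = trans (concatMap-++ qnames (pvars xs) Λ) (cong (_++ qvars Λ) (qvars-pvars xs))

qvars-++ : ∀ Λ₁ Λ₂ → qvars (Λ₁ ++ Λ₂) ↭ qvars Λ₁ ++ qvars Λ₂
qvars-++ Λ₁ Λ₂ = ↭-reflexive (concatMap-++ qnames Λ₁ Λ₂)

mutual
  ⊩-Qv : ∀ {Θ Λ M} → Θ ∣ Λ ⊩ M → qvars Λ ↭ Qv M
  ⊩-Qv ⊩c0        = ↭-refl
  ⊩-Qv ⊩c1        = ↭-refl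
  ⊩-Qv (⊩U i)     = ↭-refl
  ⊩-Qv (⊩qv r)    = ↭-refl
  ⊩-Qv (⊩lin x)   = ↭-refl
  ⊩-Qv (⊩unr x _) = ↭-refl
  ⊩-Qv (⊩! d)     = ⊩-Qv d
  ⊩-Qv (⊩new d)   = ⊩-Qv d
  ⊩-Qv (⊩app {Λ₁ = Λ₁} {Λ₂} d e) = ↭-trans (qvars-++ Λ₁ Λ₂) (++⁺ (⊩-Qv d) (⊩-Qv e))
  ⊩-Qv (⊩tup ds)  = ⊩-Qv* ds
  ⊩-Qv (⊩ƛv {M = M} L f)   = ⊩-Qv-openings {M = M} 1 L f
  ⊩-Qv (⊩ƛt {M = M} n L f) = ⊩-Qv-openings {M = M} (suc (suc n)) L f
  ⊩-Qv (⊩ƛ! {M = M} L f) with x , x∉L ∷ [] ← fresh-name (L ∷ []) =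
    ↭-trans (⊩-Qv (f x x∉L)) (↭-reflexive (Qv-open-vars (x ∷ []) M))
  ⊩-Qv (⊩exch d π) = ↭-trans (concatMap-↭ qnames (↭-sym π)) (⊩-Qv d)

  ⊩-Qv-openings : ∀ {Θ Λ M} k L → LinearOpenings Θ Λ k M L → qvars Λ ↭ Qv M
  ⊩-Qv-openings {Λ = Λ} {M} k L f with xs , len , u , xs∉L ∷ [] ← fresh-names k (L ∷ []) = begin
    qvars Λ                        ≡⟨ qvars-pvars-++ xs Λ ⟨
    qvars (pvars xs ++ Λ)          ↭⟨ ⊩-Qv (f xs len u xs∉L) ⟩
    Qv (open0 (map var xs) M)      ≡⟨ Qv-open-vars xs M ⟩
    Qv M                           ∎
    where open PermutationReasoning

  ⊩-Qv* : ∀ {Θ Λs Ms} → Θ ∣ Λs ⊩* Ms → qvars (concat Λs) ↭ QvL Ms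
  ⊩-Qv* []                     = ↭-refl
  ⊩-Qv* {Λs = Λ ∷ Λs} (d ∷ ds) = ↭-trans (qvars-++ Λ (concat Λs)) (++⁺ (⊩-Qv d) (⊩-Qv* ds))

mutual
  ⊩-strengthen : ∀ {Θ Θ′ Λ M} → (∀ {z} → z ∈ Θ → z ∈ fv M → z ∈ Θ′) → Θ ∣ Λ ⊩ M → Θ′ ∣ Λ ⊩ M
  ⊩-strengthen g ⊩c0         = ⊩c0
  ⊩-strengthen g ⊩c1         = ⊩c1
  ⊩-strengthen g (⊩U i)      = ⊩U i
  ⊩-strengthen g (⊩qv r)     = ⊩qv r
  ⊩-strengthen g (⊩lin x)    = ⊩lin x
  ⊩-strengthen g (⊩unr x q)  = ⊩unr x (g q (here refl))
  ⊩-strengthen g (⊩! d)      = ⊩! (⊩-strengthen g d)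
  ⊩-strengthen g (⊩new d)    = ⊩new (⊩-strengthen g d)
  ⊩-strengthen g (⊩app {M = M} d e) =
    ⊩app (⊩-strengthen (λ q p → g q (∈-++⁺ˡ p)) d) (⊩-strengthen (λ q p → g q (∈-++⁺ʳ (fv M) p)) e)
  ⊩-strengthen g (⊩tup ds)   = ⊩tup (⊩-strengthen* g ds)
  ⊩-strengthen g (⊩ƛv {M = M} L f)   = ⊩ƛv _ (⊩-strengthen-openings {M = M} g f)
  ⊩-strengthen g (⊩ƛt {M = M} n L f) = ⊩ƛt n _ (⊩-strengthen-openings {M = M} g f)
  ⊩-strengthen {Θ} {Θ′} g (⊩ƛ! {M = M} L f) = ⊩ƛ! L (λ y y∉L → ⊩-strengthen (g′ y) (f y y∉L))
    where
    g′ : ∀ y {z} → z ∈ y ∷ Θ → z ∈ fv (open0 (var y ∷ []) M) → z ∈ y ∷ Θ′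
    g′ y (here refl) _ = here refl
    g′ y (there q)   p with fv-open-vars⁻ (y ∷ []) M p
    ... | inj₁ z∈M = there (g q z∈M)
    ... | inj₂ (here refl) = here refl
  ⊩-strengthen g (⊩exch d π) = ⊩exch (⊩-strengthen g d) π

  ⊩-strengthen-openings : ∀ {Θ Θ′ Λ M k L} → (∀ {z} → z ∈ Θ → z ∈ fv M → z ∈ Θ′) →
                          LinearOpenings Θ Λ k M L → LinearOpenings Θ′ Λ k M (L ++ Θ)
  ⊩-strengthen-openings {Θ} {Θ′} {M = M} {L = L} g f xs len u xs∉ =
    ⊩-strengthen g′ (f xs len u (All.map ∉-++⁻ˡ xs∉))
    where
    g′ : ∀ {z} → z ∈ Θ → z ∈ fv (open0 (map var xs) M) → z ∈ Θ′
    g′ q p with fv-open-vars⁻ xs M p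
    ... | inj₁ z∈M  = g q z∈M
    ... | inj₂ z∈xs = ⊥-elim (All.lookup xs∉ z∈xs (∈-++⁺ʳ L q))

  ⊩-strengthen* : ∀ {Θ Θ′ Λs Ms} → (∀ {z} → z ∈ Θ → z ∈ fvL Ms → z ∈ Θ′) → Θ ∣ Λs ⊩* Ms → Θ′ ∣ Λs ⊩* Ms
  ⊩-strengthen* g []                  = []
  ⊩-strengthen* g (_∷_ {y = M} d ds) =
    ⊩-strengthen (λ q p → g q (∈-++⁺ˡ p)) d ∷ ⊩-strengthen* (λ q p → g q (∈-++⁺ʳ (fv M) p)) ds

⊩-remove : ∀ {Θ Λ M} xs → All (_∉ fv M) xs → Θ ∣ Λ ⊩ M → filter (_∉? xs) Θ ∣ Λ ⊩ M
⊩-remove xs xs∉M = ⊩-strengthen (λ z∈Θ z∈M → ∈-filter⁺ (_∉? xs) z∈Θ (λ z∈xs → All.lookup xs∉M z∈xs z∈M))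

map-↦-vars : ∀ {x} N ys → x ∉ ys → map (substVars (x ↦ N)) (map var ys) ≡ map var ys
map-↦-vars N []       _   = refl
map-↦-vars N (y ∷ ys) x∉ = cong₂ _∷_ (↦-other N (λ { refl → x∉ (here refl) })) (map-↦-vars N ys (x∉ ∘ there))

substVars-open-vars : ∀ {x N} ys M → x ∉ ys → lc 0 N →
                      substVars (x ↦ N) (open0 (map var ys) M) ≡ open0 (map var ys) (substVars (x ↦ N) M)
substVars-open-vars {x} {N} ys M x∉ys lcN =
  trans (substVars-inst (↦-lc lcN) 0 (map var ys) M)
        (cong (λ us → inst 0 us (substVars (x ↦ N) M)) (map-↦-vars N ys x∉ys))

∷-⊆-swap : ∀ {x y : ℕ} {Θ₁ Θ} → Θ₁ ⊆ x ∷ Θ → y ∷ Θ₁ ⊆ x ∷ y ∷ Θ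
∷-⊆-swap h (here refl) = there (here refl)
∷-⊆-swap h (there q) with h q
... | here refl = here refl
... | there q′  = there (there q′)

mutual
  ⊩-subst-unr : ∀ {Θ₁ Θ Λ M N x} → Θ₁ ∣ Λ ⊩ M → Θ₁ ⊆ x ∷ Θ → x ∉ cvars Λ → Θ ∣ [] ⊩ N →
                Θ ∣ Λ ⊩ substVars (x ↦ N) M
  ⊩-subst-unr ⊩c0    _ _ _ = ⊩c0
  ⊩-subst-unr ⊩c1    _ _ _ = ⊩c1
  ⊩-subst-unr (⊩U i) _ _ _ = ⊩U i
  ⊩-subst-unr (⊩qv r) _ _ _ = ⊩qv r
  ⊩-subst-unr {N = N} (⊩lin y) _ x∉Λ _ =
    subst (_ ∣ _ ⊩_) (sym (↦-other N (λ { refl → x∉Λ (here refl) }))) (⊩lin y)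
  ⊩-subst-unr {x = x} (⊩unr y y∈Θ₁) h _ dN with y ≟ x
  ... | yes _   = dN
  ... | no  y≢x with h y∈Θ₁
  ...   | here y≡x = ⊥-elim (y≢x y≡x)
  ...   | there y∈Θ = ⊩unr y y∈Θ
  ⊩-subst-unr (⊩! d)   h x∉Λ dN = ⊩! (⊩-subst-unr d h x∉Λ dN)
  ⊩-subst-unr (⊩new d) h x∉Λ dN = ⊩new (⊩-subst-unr d h x∉Λ dN)
  ⊩-subst-unr (⊩app {Λ₁ = Λ₁} {Λ₂} d e) h x∉Λ dN with x∉Λ₁ , x∉Λ₂ ← ∉-concatMap-++⁻ cnames Λ₁ Λ₂ x∉Λ =
    ⊩app (⊩-subst-unr d h x∉Λ₁ dN) (⊩-subst-unr e h x∉Λ₂ dN)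
  ⊩-subst-unr (⊩tup ds) h x∉Λ dN = ⊩tup (⊩-subst-unr* ds h x∉Λ dN)
  ⊩-subst-unr (⊩ƛv {M = M} L f)   h x∉Λ dN = ⊩ƛv _ (⊩-subst-unr-openings {M = M} f h x∉Λ dN)
  ⊩-subst-unr (⊩ƛt {M = M} n L f) h x∉Λ dN = ⊩ƛt n _ (⊩-subst-unr-openings {M = M} f h x∉Λ dN)
  ⊩-subst-unr {x = x} (⊩ƛ! {M = M} L f) h x∉Λ dN = ⊩ƛ! (x ∷ L) λ y y∉ →
    subst (_ ∣ _ ⊩_) (substVars-open-vars (y ∷ []) M (All∉-∷⇒∉ (y∉ ∷ [])) (⊩-lc dN))
      (⊩-subst-unr (f y (y∉ ∘ there)) (∷-⊆-swap h) x∉Λ (⊩-weaken there dN))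
  ⊩-subst-unr (⊩exch d π) h x∉Λ dN = ⊩exch (⊩-subst-unr d h (∉-concatMap-↭ cnames (↭-sym π) x∉Λ) dN) π

  ⊩-subst-unr-openings : ∀ {Θ₁ Θ Λ M N x k L} → LinearOpenings Θ₁ Λ k M L → Θ₁ ⊆ x ∷ Θ → x ∉ cvars Λ →
                         Θ ∣ [] ⊩ N → LinearOpenings Θ Λ k (substVars (x ↦ N) M) (x ∷ L)
  ⊩-subst-unr-openings {Λ = Λ} {M} f h x∉Λ dN ys len u ys∉ =
    subst (_ ∣ _ ⊩_) (substVars-open-vars ys M (All∉-∷⇒∉ ys∉) (⊩-lc dN))
      (⊩-subst-unr (f ys len u (All.map (_∘ there) ys∉)) h (∉-cvars-pvars-++ ys Λ (All∉-∷⇒∉ ys∉) x∉Λ) dN)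

  ⊩-subst-unr* : ∀ {Θ₁ Θ Λs Ms N x} → Θ₁ ∣ Λs ⊩* Ms → Θ₁ ⊆ x ∷ Θ → x ∉ cvars (concat Λs) → Θ ∣ [] ⊩ N →
                 Θ ∣ Λs ⊩* substVarsL (x ↦ N) Ms
  ⊩-subst-unr* [] _ _ _ = []
  ⊩-subst-unr* {Λs = Λ ∷ Λs} (d ∷ ds) h x∉ dN with x∉Λ , x∉Λs ← ∉-concatMap-++⁻ cnames Λ (concat Λs) x∉ =
    ⊩-subst-unr d h x∉Λ dN ∷ ⊩-subst-unr* ds h x∉Λs dN

⊩-subst-fresh : ∀ {Θ Θ′ Λ M x} N → Θ ∣ Λ ⊩ M → Θ ⊆ Θ′ → x ∉ Θ → x ∉ cvars Λ → Θ′ ∣ Λ ⊩ substVars (x ↦ N) M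
⊩-subst-fresh {M = M} N d Θ⊆ x∉Θ x∉Λ =
  subst (_ ∣ _ ⊩_) (sym (substVars-fresh N M (⊩-∉fv d x∉Θ x∉Λ))) (⊩-weaken Θ⊆ d)

⊩-subst-fresh* : ∀ {Θ Θ′ Λs Ms x} N → Θ ∣ Λs ⊩* Ms → Θ ⊆ Θ′ → x ∉ Θ → x ∉ cvars (concat Λs) →
                 Θ′ ∣ Λs ⊩* substVarsL (x ↦ N) Ms
⊩-subst-fresh* {Ms = Ms} N ds Θ⊆ x∉Θ x∉Λs =
  subst (_ ∣ _ ⊩*_) (sym (substVarsL-fresh N Ms (⊩-∉fv* ds x∉Θ x∉Λs))) (⊩-weaken* Θ⊆ ds)

↭-++-insertˡ : ∀ {A : Set} {Λ₀ : List A} B C Δ → Λ₀ ↭ B ++ C → (B ++ Δ) ++ C ↭ Λ₀ ++ Δ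
↭-++-insertˡ B C Δ π = begin
  (B ++ Δ) ++ C  ≡⟨ ++-assoc B Δ C ⟩
  B ++ Δ ++ C    ↭⟨ ++⁺ˡ B (++-comm Δ C) ⟩
  B ++ C ++ Δ    ≡⟨ ++-assoc B C Δ ⟨
  (B ++ C) ++ Δ  ↭⟨ ++⁺ʳ Δ π ⟨
  _ ++ Δ         ∎
  where open PermutationReasoning

↭-++-insertʳ : ∀ {A : Set} {Λ₀ : List A} B C Δ → Λ₀ ↭ B ++ C → B ++ C ++ Δ ↭ Λ₀ ++ Δ
↭-++-insertʳ B C Δ π = ↭-trans (↭-reflexive (sym (++-assoc B C Δ))) (++⁺ʳ Δ (↭-sym π))

-- The unrestricted context may grow (Θ ⊆ Θ′) so that dereliction is the instance N = var x.
mutual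
  ⊩-subst-lin : ∀ {Θ Θ′ Λ Λ₀ Δ M N x} → Θ ∣ Λ ⊩ M → Λ ↭ pat (pvar x) ∷ Λ₀ → Θ ⊆ Θ′ → x ∉ Θ →
                x ∉ cvars Λ₀ → Θ′ ∣ Δ ⊩ N → Θ′ ∣ Λ₀ ++ Δ ⊩ substVars (x ↦ N) M
  ⊩-subst-lin ⊩c0        π = ⊥-elim (¬x∷xs↭[] (↭-sym π))
  ⊩-subst-lin ⊩c1        π = ⊥-elim (¬x∷xs↭[] (↭-sym π))
  ⊩-subst-lin (⊩U i)     π = ⊥-elim (¬x∷xs↭[] (↭-sym π))
  ⊩-subst-lin (⊩unr y _) π = ⊥-elim (¬x∷xs↭[] (↭-sym π))
  ⊩-subst-lin (⊩! d)     π = ⊥-elim (¬x∷xs↭[] (↭-sym π))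
  ⊩-subst-lin (⊩qv r)    π with () ← ↭-singleton-inv (↭-sym π)
  ⊩-subst-lin {N = N} {x} (⊩lin y) π _ _ _ dN with refl ← ↭-singleton-inv (↭-sym π) =
    subst (_ ∣ _ ⊩_) (sym (↦-same x N)) dN
  ⊩-subst-lin (⊩new d) π Θ⊆ x∉Θ x∉Λ₀ dN = ⊩new (⊩-subst-lin d π Θ⊆ x∉Θ x∉Λ₀ dN)
  ⊩-subst-lin {Δ = Δ} {N = N} (⊩app {Λ₁ = Λ₁} {Λ₂} d e) π Θ⊆ x∉Θ x∉Λ₀ dN with ↭-∷-split Λ₁ Λ₂ π
  ... | inj₁ (B , πΛ₁ , πΛ₀) with x∉B , x∉Λ₂ ← ∉-cvars-split B Λ₂ x∉Λ₀ πΛ₀ =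
    ⊩exch (⊩app (⊩-subst-lin d πΛ₁ Θ⊆ x∉Θ x∉B dN) (⊩-subst-fresh N e Θ⊆ x∉Θ x∉Λ₂)) (↭-++-insertˡ B Λ₂ Δ πΛ₀)
  ... | inj₂ (B , πΛ₂ , πΛ₀) with x∉Λ₁ , x∉B ← ∉-cvars-split Λ₁ B x∉Λ₀ πΛ₀ =
    ⊩exch (⊩app (⊩-subst-fresh N d Θ⊆ x∉Θ x∉Λ₁) (⊩-subst-lin e πΛ₂ Θ⊆ x∉Θ x∉B dN)) (↭-++-insertʳ Λ₁ B Δ πΛ₀)
  ⊩-subst-lin (⊩tup ds) π Θ⊆ x∉Θ x∉Λ₀ dN with _ , ds′ , π′ ← ⊩-subst-lin* ds π Θ⊆ x∉Θ x∉Λ₀ dN =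
    ⊩exch (⊩tup ds′) π′
  ⊩-subst-lin (⊩ƛv {M = M} L f)   π Θ⊆ x∉Θ x∉Λ₀ dN = ⊩ƛv _ (⊩-subst-lin-openings {M = M} f π Θ⊆ x∉Θ x∉Λ₀ dN)
  ⊩-subst-lin (⊩ƛt {M = M} n L f) π Θ⊆ x∉Θ x∉Λ₀ dN = ⊩ƛt n _ (⊩-subst-lin-openings {M = M} f π Θ⊆ x∉Θ x∉Λ₀ dN)
  ⊩-subst-lin {x = x} (⊩ƛ! {M = M} L f) π Θ⊆ x∉Θ x∉Λ₀ dN = ⊩ƛ! (x ∷ L) λ y y∉ →
    subst (_ ∣ _ ⊩_) (substVars-open-vars (y ∷ []) M (All∉-∷⇒∉ (y∉ ∷ [])) (⊩-lc dN))
      (⊩-subst-lin (f y (y∉ ∘ there)) π (∷⁺ʳ y Θ⊆) (λ { (here refl) → y∉ (here refl) ; (there x∈Θ) → x∉Θ x∈Θ })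
                   x∉Λ₀ (⊩-weaken there dN))
  ⊩-subst-lin (⊩exch d π₁) π = ⊩-subst-lin d (↭-trans π₁ π)

  ⊩-subst-lin-openings : ∀ {Θ Θ′ Λ Λ₀ Δ M N x k L} → LinearOpenings Θ Λ k M L → Λ ↭ pat (pvar x) ∷ Λ₀ →
                         Θ ⊆ Θ′ → x ∉ Θ → x ∉ cvars Λ₀ → Θ′ ∣ Δ ⊩ N →
                         LinearOpenings Θ′ (Λ₀ ++ Δ) k (substVars (x ↦ N) M) (x ∷ L)
  ⊩-subst-lin-openings {Λ₀ = Λ₀} {Δ} {M} f π Θ⊆ x∉Θ x∉Λ₀ dN ys len u ys∉ =
    ⊩exch (subst (_ ∣ _ ⊩_) (substVars-open-vars ys M (All∉-∷⇒∉ ys∉) (⊩-lc dN))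
                 (⊩-subst-lin (f ys len u (All.map (_∘ there) ys∉))
                              (↭-trans (++⁺ˡ (pvars ys) π) (shift _ (pvars ys) Λ₀))
                              Θ⊆ x∉Θ (∉-cvars-pvars-++ ys Λ₀ (All∉-∷⇒∉ ys∉) x∉Λ₀) dN))
          (↭-reflexive (++-assoc (pvars ys) Λ₀ Δ))

  ⊩-subst-lin* : ∀ {Θ Θ′ Λs Λ₀ Δ Ms N x} → Θ ∣ Λs ⊩* Ms → concat Λs ↭ pat (pvar x) ∷ Λ₀ → Θ ⊆ Θ′ → x ∉ Θ →
                 x ∉ cvars Λ₀ → Θ′ ∣ Δ ⊩ N →
                 ∃ λ Λs′ → Θ′ ∣ Λs′ ⊩* substVarsL (x ↦ N) Ms × concat Λs′ ↭ Λ₀ ++ Δ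
  ⊩-subst-lin* [] π = ⊥-elim (¬x∷xs↭[] (↭-sym π))
  ⊩-subst-lin* {Λs = Λ ∷ Λs} {Δ = Δ} {N = N} (d ∷ ds) π Θ⊆ x∉Θ x∉Λ₀ dN with ↭-∷-split Λ (concat Λs) π
  ... | inj₁ (B , πΛ , πΛ₀) with x∉B , x∉Λs ← ∉-cvars-split B (concat Λs) x∉Λ₀ πΛ₀ =
    (B ++ Δ) ∷ Λs , ⊩-subst-lin d πΛ Θ⊆ x∉Θ x∉B dN ∷ ⊩-subst-fresh* N ds Θ⊆ x∉Θ x∉Λs ,
    ↭-++-insertˡ B (concat Λs) Δ πΛ₀
  ... | inj₂ (B , πΛs , πΛ₀) with x∉Λ , x∉B ← ∉-cvars-split Λ B x∉Λ₀ πΛ₀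
    with Λs′ , ds′ , π′ ← ⊩-subst-lin* ds πΛs Θ⊆ x∉Θ x∉B dN =
    Λ ∷ Λs′ , ⊩-subst-fresh N d Θ⊆ x∉Θ x∉Λ ∷ ds′ , ↭-trans (++⁺ˡ Λ π′) (↭-++-insertʳ Λ B Δ πΛ₀)

⊩-derelict : ∀ {Θ Θ′ Λ₀ M x} → Θ ∣ pat (pvar x) ∷ Λ₀ ⊩ M → x ∷ Θ ⊆ Θ′ → x ∉ Θ → x ∉ cvars Λ₀ → Θ′ ∣ Λ₀ ⊩ M
⊩-derelict {Θ′ = Θ′} {Λ₀} {M} {x} d h x∉Θ x∉Λ₀ =
  subst₂ (Θ′ ∣_⊩_) (++-identityʳ Λ₀) (substVars-↦-self x M)
    (⊩-subst-lin d ↭-refl (h ∘ there) x∉Θ x∉Λ₀ (⊩unr x (h (here refl))))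

map-substVars≡substVarsL : ∀ σ Ms → map (substVars σ) Ms ≡ substVarsL σ Ms
map-substVars≡substVarsL σ []       = refl
map-substVars≡substVarsL σ (M ∷ Ms) = cong (substVars σ M ∷_) (map-substVars≡substVarsL σ Ms)

fvL-++ : ∀ Ms Ns → fvL (Ms ++ Ns) ≡ fvL Ms ++ fvL Ns
fvL-++ []       Ns = refl
fvL-++ (M ∷ Ms) Ns = trans (cong (fv M ++_) (fvL-++ Ms Ns)) (sym (++-assoc (fv M) (fvL Ms) (fvL Ns)))

substVars-open-step : ∀ {x} N Ps xs M → lc 0 N → x ∉ fv M → x ∉ fvL Ps → x ∉ xs →
                      substVars (x ↦ N) (open0 (Ps ++ var x ∷ map var xs) M) ≡
                      open0 ((Ps ++ N ∷ []) ++ map var xs) M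
substVars-open-step {x} N Ps xs M lcN x∉M x∉Ps x∉xs = begin
  substVars σ (open0 (Ps ++ var x ∷ map var xs) M)
    ≡⟨ substVars-inst (↦-lc lcN) 0 (Ps ++ var x ∷ map var xs) M ⟩
  open0 (map (substVars σ) (Ps ++ var x ∷ map var xs)) (substVars σ M)
    ≡⟨ cong₂ open0 (map-++ (substVars σ) Ps (var x ∷ map var xs)) (substVars-fresh N M x∉M) ⟩
  open0 (map (substVars σ) Ps ++ σ x ∷ map (substVars σ) (map var xs)) M
    ≡⟨ cong (λ us → open0 us M)
            (cong₃ (λ Qs P Rs → Qs ++ P ∷ Rs) Ps-fixed (↦-same x N) (map-↦-vars N xs x∉xs)) ⟩
  open0 (Ps ++ N ∷ map var xs) M
    ≡⟨ cong (λ us → open0 us M) (++-assoc Ps (N ∷ []) (map var xs)) ⟨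
  open0 ((Ps ++ N ∷ []) ++ map var xs) M ∎
  where
  open ≡-Reasoning
  σ : ℕ → Term
  σ = x ↦ N
  Ps-fixed : map (substVars σ) Ps ≡ Ps
  Ps-fixed = trans (map-substVars≡substVarsL σ Ps) (substVarsL-fresh N Ps x∉Ps)

-- Ps are the terms already substituted for the preceding variables of the opening.
⊩-open-subst-from : ∀ {Θ Λ M} Ps xs {Δs Ns} → Θ ∣ pvars xs ++ Λ ⊩ open0 (Ps ++ map var xs) M →
                    Θ ∣ Δs ⊩* Ns → length xs ≡ length Ns → Unique xs → All (_∉ Θ) xs → All (_∉ cvars Λ) xs →
                    All (_∉ fv M) xs → All (_∉ fvL Ps) xs → All (_∉ fvL Ns) xs →
                    Θ ∣ Λ ++ concat Δs ⊩ open0 (Ps ++ Ns) M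
⊩-open-subst-from {Θ} {Λ} Ps [] d [] _ _ _ _ _ _ _ = subst (Θ ∣_⊩ _) (sym (++-identityʳ Λ)) d
⊩-open-subst-from {Θ} {Λ} {M} Ps (x ∷ xs) {Δ ∷ Δs} {N ∷ Ns} d (dN ∷ dNs) len
  (x∉xs ∷ uniq) (x∉Θ ∷ xs∉Θ) (x∉Λ ∷ xs∉Λ) (x∉M ∷ xs∉M) (x∉Ps ∷ xs∉Ps) (_ ∷ xs∉NNs) =
  subst₂ (Θ ∣_⊩_) (++-assoc Λ Δ (concat Δs)) (cong (λ us → open0 us M) (++-assoc Ps (N ∷ []) Ns))
    (⊩-open-subst-from {M = M} (Ps ++ N ∷ []) xs dx dNs (suc-injective len) uniq xs∉Θ xs∉ΛΔ xs∉M xs∉PsN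
                       (All.map (∉-++⁻ʳ (fv N)) xs∉NNs))
  where
  x∉xs′ : x ∉ xs
  x∉xs′ = All¬⇒¬Any x∉xs
  dx : Θ ∣ pvars xs ++ Λ ++ Δ ⊩ open0 ((Ps ++ N ∷ []) ++ map var xs) M
  dx = subst₂ (Θ ∣_⊩_) (++-assoc (pvars xs) Λ Δ) (substVars-open-step N Ps xs M (⊩-lc dN) x∉M x∉Ps x∉xs′)
              (⊩-subst-lin d ↭-refl ⊆-refl x∉Θ (∉-cvars-pvars-++ xs Λ x∉xs′ x∉Λ) dN)
  xs∉ΛΔ : All (_∉ cvars (Λ ++ Δ)) xs
  xs∉ΛΔ = All.zipWith (λ (y∉Λ , y∉NNs) → ∉-concatMap-++⁺ cnames Λ Δ y∉Λ (λ p → y∉NNs (∈-++⁺ˡ (⊩-cvars dN p))))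
                      (xs∉Λ , xs∉NNs)
  xs∉PsN : All (_∉ fvL (Ps ++ N ∷ [])) xs
  xs∉PsN = All.zipWith (λ (y∉Ps , y∉NNs) → subst (_ ∉_) (sym (fvL-++ Ps (N ∷ [])))
                          (∉-++⁺ (fvL Ps) y∉Ps (λ p → y∉NNs (∈-++⁺ˡ (subst (_ ∈_) (++-identityʳ (fv N)) p)))))
                       (xs∉Ps , xs∉NNs)

⊩-open-subst : ∀ {Θ Λ M} xs {Δs Ns} → Θ ∣ pvars xs ++ Λ ⊩ open0 (map var xs) M → Θ ∣ Δs ⊩* Ns →
               length xs ≡ length Ns → Unique xs → All (_∉ Θ) xs → All (_∉ cvars Λ) xs → All (_∉ fv M) xs →
               All (_∉ fvL Ns) xs → Θ ∣ Λ ++ concat Δs ⊩ open0 Ns M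
⊩-open-subst {M = M} xs d dNs len uniq xs∉Θ xs∉Λ xs∉M =
  ⊩-open-subst-from {M = M} [] xs d dNs len uniq xs∉Θ xs∉Λ xs∉M (All.universal (λ _ ()) xs)

substVars-open1 : ∀ {x} N M → lc 0 N → x ∉ fv M → substVars (x ↦ N) (open0 (var x ∷ []) M) ≡ open0 (N ∷ []) M
substVars-open1 N M lcN x∉M = substVars-open-step N [] [] M lcN x∉M (λ ()) (λ ())

singletons : List ℕ → List Env
singletons = map (λ y → pat (pvar y) ∷ [])

concat-singletons : ∀ ys → concat (singletons ys) ≡ pvars ys
concat-singletons []       = refl
concat-singletons (y ∷ ys) = cong (pat (pvar y) ∷_) (concat-singletons ys)

⊩-lin* : ∀ {Θ} ys → Θ ∣ singletons ys ⊩* map var ys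
⊩-lin* []       = []
⊩-lin* (y ∷ ys) = ⊩lin y ∷ ⊩-lin* ys

⊩-rename-opening : ∀ {Θ Λ M} xs ys → Θ ∣ pvars xs ++ Λ ⊩ open0 (map var xs) M → length xs ≡ length ys →
                   Unique xs → All (_∉ Θ) xs → All (_∉ cvars Λ) xs → All (_∉ fv M) xs → All (_∉ ys) xs →
                   Θ ∣ pvars ys ++ Λ ⊩ open0 (map var ys) M
⊩-rename-opening {Θ} {Λ} {M} xs ys d len uniq xs∉Θ xs∉Λ xs∉M xs∉ys =
  ⊩exch (subst (λ Δ → Θ ∣ Λ ++ Δ ⊩ open0 (map var ys) M) (concat-singletons ys)
           (⊩-open-subst {M = M} xs d (⊩-lin* ys) (trans len (sym (length-map var ys))) uniq xs∉Θ xs∉Λ xs∉M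
                         (subst (λ zs → All (_∉ zs) xs) (sym (fvL-map-var ys)) xs∉ys)))
        (++-comm Λ (pvars ys))

⊩-openings-intro : ∀ {Θ Λ M} xs → Θ ∣ pvars xs ++ Λ ⊩ open0 (map var xs) M → Unique xs →
                   All (_∉ Θ) xs → All (_∉ cvars Λ) xs → All (_∉ fv M) xs → LinearOpenings Θ Λ (length xs) M xs
⊩-openings-intro {M = M} xs d uniq xs∉Θ xs∉Λ xs∉M ys len _ ys∉xs =
  ⊩-rename-opening {M = M} xs ys d (sym len) uniq xs∉Θ xs∉Λ xs∉M (All∉-sym ys∉xs)

⊩-openings-at : ∀ {Θ Λ M k L} → LinearOpenings Θ Λ k M L → ∀ ys → length ys ≡ k →
                Θ ∣ pvars ys ++ Λ ⊩ open0 (map var ys) M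
⊩-openings-at {Θ} {Λ} {M} {k} {L} f ys len
  with xs , lenxs , uniq , xs∉L ∷ xs∉Θ ∷ xs∉Λ ∷ xs∉M ∷ xs∉ys ∷ [] ←
       fresh-names k (L ∷ Θ ∷ cvars Λ ∷ fv M ∷ ys ∷ [])
  = ⊩-rename-opening {M = M} xs ys (f xs lenxs uniq xs∉L) (trans lenxs (sym len)) uniq xs∉Θ xs∉Λ xs∉M xs∉ys

⊩-openings-↭ : ∀ {Θ Λ Λ′ k M L} → LinearOpenings Θ Λ k M L → Λ ↭ Λ′ → LinearOpenings Θ Λ′ k M L
⊩-openings-↭ f π xs len uniq xs∉L = ⊩exch (f xs len uniq xs∉L) (++⁺ˡ (pvars xs) π)

⊩ƛ!-intro : ∀ {Θ Λ M} x → x ∷ Θ ∣ Λ ⊩ open0 (var x ∷ []) M → x ∉ cvars Λ → x ∉ fv M → Θ ∣ Λ ⊩ ƛ! M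
⊩ƛ!-intro {M = M} x d x∉Λ x∉M = ⊩ƛ! [] λ y _ →
  subst (_ ∣ _ ⊩_) (substVars-open1 (var y) M tt x∉M)
        (⊩-subst-unr d (∷⁺ʳ x (xs⊆x∷xs _ y)) x∉Λ (⊩unr y (here refl)))

arity : PBinder → ℕ
arity bV     = 1
arity (bT n) = suc (suc n)

⊩lamπ : ∀ {Θ Λ M} b L → LinearOpenings Θ Λ (arity b) M L → Θ ∣ Λ ⊩ lamπ b M
⊩lamπ bV     = ⊩ƛv
⊩lamπ (bT n) = ⊩ƛt n

⊩-app⁻ : ∀ {Θ Λ M N} → Θ ∣ Λ ⊩ M · N → ∃ λ Λ₁ → ∃ λ Λ₂ → Θ ∣ Λ₁ ⊩ M × Θ ∣ Λ₂ ⊩ N × Λ₁ ++ Λ₂ ↭ Λ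
⊩-app⁻ (⊩app d e)  = _ , _ , d , e , ↭-refl
⊩-app⁻ (⊩exch d π) with Λ₁ , Λ₂ , d₁ , d₂ , π′ ← ⊩-app⁻ d = Λ₁ , Λ₂ , d₁ , d₂ , ↭-trans π′ π

⊩-tup⁻ : ∀ {Θ Λ M N Ms} → Θ ∣ Λ ⊩ tup M N Ms → ∃ λ Λs → Θ ∣ Λs ⊩* (M ∷ N ∷ Ms) × concat Λs ↭ Λ
⊩-tup⁻ (⊩tup ds)   = _ , ds , ↭-refl
⊩-tup⁻ (⊩exch d π) with Λs , ds , π′ ← ⊩-tup⁻ d = Λs , ds , ↭-trans π′ π

⊩-new⁻ : ∀ {Θ Λ M} → Θ ∣ Λ ⊩ new M → Θ ∣ Λ ⊩ M
⊩-new⁻ (⊩new d)    = d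
⊩-new⁻ (⊩exch d π) = ⊩exch (⊩-new⁻ d) π

⊩-!⁻ : ∀ {Θ Λ M} → Θ ∣ Λ ⊩ ! M → Θ ∣ [] ⊩ M × [] ↭ Λ
⊩-!⁻ (⊩! d)      = d , ↭-refl
⊩-!⁻ (⊩exch d π) with d′ , π′ ← ⊩-!⁻ d = d′ , ↭-trans π′ π

⊩-U⁻ : ∀ {Θ Λ i} → Θ ∣ Λ ⊩ U i → [] ↭ Λ
⊩-U⁻ (⊩U i)      = ↭-refl
⊩-U⁻ (⊩exch d π) = ↭-trans (⊩-U⁻ d) π

⊩-bit⁻ : ∀ {Θ Λ} c → Θ ∣ Λ ⊩ bitTerm c → [] ↭ Λ
⊩-bit⁻ false ⊩c0         = ↭-refl
⊩-bit⁻ true  ⊩c1         = ↭-refl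
⊩-bit⁻ c     (⊩exch d π) = ↭-trans (⊩-bit⁻ c d) π

⊩-lamπ⁻ : ∀ {Θ Λ M} b → Θ ∣ Λ ⊩ lamπ b M → ∃ λ L → LinearOpenings Θ Λ (arity b) M L
⊩-lamπ⁻ bV     (⊩ƛv L f)    = L , f
⊩-lamπ⁻ bV     (⊩exch {M = ƛv M} d π)  with L , f ← ⊩-lamπ⁻ bV d = L , ⊩-openings-↭ {M = M} f π
⊩-lamπ⁻ (bT n) (⊩ƛt .n L f) = L , f
⊩-lamπ⁻ (bT n) (⊩exch {M = ƛt _ M} d π) with L , f ← ⊩-lamπ⁻ (bT n) d = L , ⊩-openings-↭ {M = M} f π

⊩-ƛ!⁻ : ∀ {Θ Λ M} → Θ ∣ Λ ⊩ ƛ! M → ∃ λ L → ∀ x → x ∉ L → x ∷ Θ ∣ Λ ⊩ open0 (var x ∷ []) M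
⊩-ƛ!⁻ (⊩ƛ! L f)   = L , f
⊩-ƛ!⁻ (⊩exch d π) with L , f ← ⊩-ƛ!⁻ d = L , λ x x∉L → ⊩exch (f x x∉L) π

-- Subject reduction

data NewQubits (V : List ℕ) : Env → Set where
  none : NewQubits V []
  one  : ∀ r → r ∉ V → NewQubits V (qit r ∷ [])

NewQubits-cvars : ∀ {V E} → NewQubits V E → cvars E ≡ []
NewQubits-cvars none      = refl
NewQubits-cvars (one r _) = refl

⊩*-step : ∀ {Θ K K′} {P : Env → Set} As {Bs Λs} → Θ ∣ Λs ⊩* (As ++ K ∷ Bs) →
          (∀ {Λ} → Θ ∣ Λ ⊩ K → ∃ λ E → P E × Θ ∣ E ++ Λ ⊩ K′) →
          ∃ λ E → P E × ∃ λ Λs′ → Θ ∣ Λs′ ⊩* (As ++ K′ ∷ Bs) × concat Λs′ ↭ E ++ concat Λs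
⊩*-step []       {Λs = Λ ∷ Λs} (d ∷ ds) step with E , p , d′ ← step d =
  E , p , (E ++ Λ) ∷ Λs , d′ ∷ ds , ↭-reflexive (++-assoc E Λ (concat Λs))
⊩*-step (A ∷ As) {Λs = Λ ∷ Λs} (d ∷ ds) step with E , p , Λs′ , ds′ , π ← ⊩*-step As ds step =
  E , p , Λ ∷ Λs′ , d ∷ ds′ , ↭-trans (++⁺ˡ Λ π) (shifts Λ E)

fv-lamπ : ∀ b M → fv (lamπ b M) ≡ fv M
fv-lamπ bV     M = refl
fv-lamπ (bT n) M = refl

-- The reduction fixes the names zs of a step under a binder; they may occur in the unrestricted
-- context (though not free in the body), so they are removed from it first.
⊩-lamπ-step : ∀ {Θ Λ M M′ V} b zs → length zs ≡ arity b → Unique zs → All (_∉ fv M) zs → All (_∉ fv M′) zs →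
              Θ ∣ Λ ⊩ lamπ b M →
              (∀ {Θ₀} → Θ₀ ∣ pvars zs ++ Λ ⊩ open0 (map var zs) M →
                 ∃ λ E → NewQubits V E × Θ₀ ∣ E ++ pvars zs ++ Λ ⊩ open0 (map var zs) M′) →
              ∃ λ E → NewQubits V E × Θ ∣ E ++ Λ ⊩ lamπ b M′
⊩-lamπ-step {Θ} {Λ} {M} {M′} b zs len uniq zs∉M zs∉M′ d step
  with L , f ← ⊩-lamπ⁻ b (⊩-remove zs (subst (λ xs → All (_∉ xs) zs) (sym (fv-lamπ b M)) zs∉M) d)
  with E , nq , d′ ← step (⊩-openings-at {M = M} f zs len)
  = E , nq , ⊩-weaken (proj₁ ∘ ∈-filter⁻ (_∉? zs))
                (⊩lamπ b zs (subst (λ k → LinearOpenings _ _ k M′ zs) len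
                  (⊩-openings-intro {M = M′} zs (⊩exch d′ (shifts E (pvars zs))) uniq zs∉Θ₀ zs∉EΛ zs∉M′)))
  where
  zs∉Θ₀ : All (_∉ filter (_∉? zs) Θ) zs
  zs∉Θ₀ = All.tabulate λ z∈zs p → proj₂ (∈-filter⁻ (_∉? zs) {xs = Θ} p) z∈zs
  zs∉EΛ : All (_∉ cvars (E ++ Λ)) zs
  zs∉EΛ = All.map (λ z∉M → ∉-concatMap-++⁺ cnames E Λ (subst (_ ∉_) (sym (NewQubits-cvars nq)) λ ())
                                             (λ p → z∉M (subst (_ ∈_) (fv-lamπ b M) (⊩-cvars d p))))
                  zs∉M

∉-fvL-map-qv : ∀ {z} rs → z ∉ fvL (map qv rs)
∉-fvL-map-qv (r ∷ rs) = ∉-fvL-map-qv rs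

⊩-U-app : ∀ {Θ Λ i N} → Θ ∣ Λ ⊩ U i · N → Θ ∣ Λ ⊩ N
⊩-U-app d with Λ₁ , Λ₂ , d₁ , d₂ , π ← ⊩-app⁻ d = ⊩exch d₂ (↭-trans (++⁺ʳ Λ₂ (⊩-U⁻ d₁)) π)

⊩-new-bit : ∀ {Θ Λ} c r → Θ ∣ Λ ⊩ new (bitTerm c) → Θ ∣ qit r ∷ Λ ⊩ qv r
⊩-new-bit c r d = ⊩exch (⊩qv r) (↭-prep (qit r) (⊩-bit⁻ c (⊩-new⁻ d)))

⊩-lβ : ∀ {Θ Λ M N} → Θ ∣ Λ ⊩ ƛv M · N → Θ ∣ Λ ⊩ open0 (N ∷ []) M
⊩-lβ {Θ} {M = M} {N} d
  with Λ₁ , Λ₂ , d₁ , d₂ , π ← ⊩-app⁻ d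
  with L , f ← ⊩-lamπ⁻ bV d₁
  with x , x∉L ∷ x∉Θ ∷ x∉Λ₁ ∷ x∉M ∷ [] ← fresh-name (L ∷ Θ ∷ cvars Λ₁ ∷ fv M ∷ [])
  = ⊩exch (subst (_ ∣ _ ⊩_) (substVars-open1 N M (⊩-lc d₂) x∉M)
                 (⊩-subst-lin (f (x ∷ []) refl ([] ∷ []) (x∉L ∷ [])) ↭-refl ⊆-refl x∉Θ x∉Λ₁ d₂))
          π

⊩-qβ : ∀ {Θ Λ M} r₁ r₂ rs → Θ ∣ Λ ⊩ ƛt (length rs) M · tup (qv r₁) (qv r₂) (map qv rs) →
       Θ ∣ Λ ⊩ open0 (map qv (r₁ ∷ r₂ ∷ rs)) M
⊩-qβ {Θ} {M = M} r₁ r₂ rs d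
  with Λ₁ , Λ₂ , d₁ , d₂ , π ← ⊩-app⁻ d
  with L , f ← ⊩-lamπ⁻ (bT (length rs)) d₁
  with Λs , ds , π₂ ← ⊩-tup⁻ d₂
  with xs , len , uniq , xs∉L ∷ xs∉Θ ∷ xs∉Λ₁ ∷ xs∉M ∷ [] ←
       fresh-names (suc (suc (length rs))) (L ∷ Θ ∷ cvars Λ₁ ∷ fv M ∷ [])
  = ⊩exch (⊩-open-subst {M = M} xs (f xs len uniq xs∉L) ds
                        (trans len (cong (suc ∘ suc) (sym (length-map qv rs))))
                        uniq xs∉Θ xs∉Λ₁ xs∉M (All.universal (λ _ → ∉-fvL-map-qv rs) xs))
          (↭-trans (++⁺ˡ Λ₁ π₂) π)

⊩-cβ : ∀ {Θ Λ M N} → Θ ∣ Λ ⊩ ƛ! M · ! N → Θ ∣ Λ ⊩ open0 (N ∷ []) M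
⊩-cβ {M = M} {N} d
  with Λ₁ , Λ₂ , d₁ , d₂ , π ← ⊩-app⁻ d
  with L , f ← ⊩-ƛ!⁻ d₁
  with dN , π₂ ← ⊩-!⁻ d₂
  with x , x∉L ∷ x∉Λ₁ ∷ x∉M ∷ [] ← fresh-name (L ∷ cvars Λ₁ ∷ fv M ∷ [])
  = ⊩exch (subst (_ ∣ _ ⊩_) (substVars-open1 N M (⊩-lc dN) x∉M) (⊩-subst-unr (f x x∉L) ⊆-refl x∉Λ₁ dN))
          (↭-trans (↭-reflexive (sym (++-identityʳ Λ₁))) (↭-trans (++⁺ˡ Λ₁ π₂) π))

⊩-lcm : ∀ {Θ Λ P M N} b → Θ ∣ Λ ⊩ P · (lamπ b M · N) → Θ ∣ Λ ⊩ lamπ b (P · M) · N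
⊩-lcm {Θ} {Λ} {P} {M} b d
  with ΛP , Λr , dP , dr , π ← ⊩-app⁻ d
  with Λλ , ΛN , dλ , dN , π′ ← ⊩-app⁻ dr
  with L , f ← ⊩-lamπ⁻ b dλ
  = ⊩exch (⊩app (⊩lamπ b L body) dN) (↭-trans (↭-reflexive (++-assoc ΛP Λλ ΛN)) (↭-trans (++⁺ˡ ΛP π′) π))
  where
  body : LinearOpenings Θ (ΛP ++ Λλ) (arity b) (P · M) L
  body xs len uniq xs∉L =
    ⊩exch (subst (λ t → Θ ∣ ΛP ++ pvars xs ++ Λλ ⊩ t · open0 (map var xs) M)
                 (sym (inst-lc 0 (map var xs) P (⊩-lc dP))) (⊩app dP (f xs len uniq xs∉L)))
          (shifts ΛP (pvars xs))

⊩-rcm : ∀ {Θ Λ P M N} b → Θ ∣ Λ ⊩ (lamπ b M · N) · P → Θ ∣ Λ ⊩ lamπ b (M · P) · N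
⊩-rcm {Θ} {Λ} {P} {M} b d
  with Λr , ΛP , dr , dP , π ← ⊩-app⁻ d
  with Λλ , ΛN , dλ , dN , π′ ← ⊩-app⁻ dr
  with L , f ← ⊩-lamπ⁻ b dλ
  = ⊩exch (⊩app (⊩lamπ b L body) dN) perm
  where
  body : LinearOpenings Θ (Λλ ++ ΛP) (arity b) (M · P) L
  body xs len uniq xs∉L =
    subst₂ (Θ ∣_⊩_) (++-assoc (pvars xs) Λλ ΛP)
           (cong (open0 (map var xs) M ·_) (sym (inst-lc 0 (map var xs) P (⊩-lc dP))))
           (⊩app (f xs len uniq xs∉L) dP)
  perm : (Λλ ++ ΛP) ++ ΛN ↭ Λ
  perm = begin
    (Λλ ++ ΛP) ++ ΛN  ≡⟨ ++-assoc Λλ ΛP ΛN ⟩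
    Λλ ++ ΛP ++ ΛN    ↭⟨ ++⁺ˡ Λλ (++-comm ΛP ΛN) ⟩
    Λλ ++ ΛN ++ ΛP    ≡⟨ ++-assoc Λλ ΛN ΛP ⟨
    (Λλ ++ ΛN) ++ ΛP  ↭⟨ ++⁺ʳ ΛP π′ ⟩
    Λr ++ ΛP          ↭⟨ π ⟩
    Λ                 ∎
    where open PermutationReasoning

module _ (𝓜 : QModel) where
  open Reduction 𝓜

  ⊩-subject-reduction : ∀ {C D Θ Λ} → C ⟶ᵣ D → Θ ∣ Λ ⊩ Conf.tm C →
                        ∃ λ E → NewQubits (Conf.qs C) E × Θ ∣ E ++ Λ ⊩ Conf.tm D
  ⊩-subject-reduction (Uq i r rs _)   d = [] , none , ⊩-U-app d
  ⊩-subject-reduction (newR c r r∉V)  d = qit r ∷ [] , one r r∉V , ⊩-new-bit c r d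
  ⊩-subject-reduction lβ              d = [] , none , ⊩-lβ d
  ⊩-subject-reduction (qβ r₁ r₂ rs)   d = [] , none , ⊩-qβ r₁ r₂ rs d
  ⊩-subject-reduction cβ              d = [] , none , ⊩-cβ d
  ⊩-subject-reduction (lcm b)         d = [] , none , ⊩-lcm b d
  ⊩-subject-reduction (rcm b)         d = [] , none , ⊩-rcm b d
  ⊩-subject-reduction (tup₁ red) d
    with Λs , ds , π ← ⊩-tup⁻ d
    with E , nq , Λs′ , ds′ , π′ ← ⊩*-step [] ds (⊩-subject-reduction red)
    = E , nq , ⊩exch (⊩tup ds′) (↭-trans π′ (++⁺ˡ E π))
  ⊩-subject-reduction (tup₂ {M = M} red) d
    with Λs , ds , π ← ⊩-tup⁻ d
    with E , nq , Λs′ , ds′ , π′ ← ⊩*-step (M ∷ []) ds (⊩-subject-reduction red)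
    = E , nq , ⊩exch (⊩tup ds′) (↭-trans π′ (++⁺ˡ E π))
  ⊩-subject-reduction (tupₙ {M = M} {N} {As} red) d
    with Λs , ds , π ← ⊩-tup⁻ d
    with E , nq , Λs′ , ds′ , π′ ← ⊩*-step (M ∷ N ∷ As) ds (⊩-subject-reduction red)
    = E , nq , ⊩exch (⊩tup ds′) (↭-trans π′ (++⁺ˡ E π))
  ⊩-subject-reduction (appL red) d
    with Λ₁ , Λ₂ , d₁ , d₂ , π ← ⊩-app⁻ d
    with E , nq , d₁′ ← ⊩-subject-reduction red d₁
    = E , nq , ⊩exch (⊩app d₁′ d₂) (↭-trans (↭-reflexive (++-assoc E Λ₁ Λ₂)) (++⁺ˡ E π))
  ⊩-subject-reduction (appR red) d
    with Λ₁ , Λ₂ , d₁ , d₂ , π ← ⊩-app⁻ d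
    with E , nq , d₂′ ← ⊩-subject-reduction red d₂
    = E , nq , ⊩exch (⊩app d₁ d₂′) (↭-trans (shifts Λ₁ E) (++⁺ˡ E π))
  ⊩-subject-reduction (lamVR x x∉M x∉M′ red) d =
    ⊩-lamπ-step bV (x ∷ []) refl ([] ∷ []) (x∉M ∷ []) (x∉M′ ∷ []) d (⊩-subject-reduction red)
  ⊩-subject-reduction (lamTR x y xs uniq zs∉ red) d =
    ⊩-lamπ-step (bT (length xs)) (x ∷ y ∷ xs) refl uniq (All.map proj₁ zs∉) (All.map proj₂ zs∉) d
                (⊩-subject-reduction red)

-- From Γ ⊢ M to Θ ∣ Λ ⊩ M

Unique-resp-↭ : ∀ {xs ys : List ℕ} → xs ↭ ys → Unique xs → Unique ys
Unique-resp-↭ π = PermS.Unique-resp-↭ (↭⇒↭ₛ π)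

Unique-++⁻ : ∀ (xs : List ℕ) {ys} → Unique (xs ++ ys) → Unique xs × Unique ys × All (_∉ ys) xs
Unique-++⁻ []       u          = [] , u , []
Unique-++⁻ (x ∷ xs) (x∉ ∷ u) with uxs , uys , xs∉ys ← Unique-++⁻ xs u =
  AllP.++⁻ˡ xs x∉ ∷ uxs , uys , All¬⇒¬Any (AllP.++⁻ʳ xs x∉) ∷ xs∉ys

Unique-++⁺ : ∀ {xs ys : List ℕ} → Unique xs → Unique ys → All (_∉ ys) xs → Unique (xs ++ ys)
Unique-++⁺ []            uys []              = uys
Unique-++⁺ (x∉xs ∷ uxs)  uys (x∉ys ∷ xs∉ys) = AllP.++⁺ x∉xs (¬Any⇒All¬ _ x∉ys) ∷ Unique-++⁺ uxs uys xs∉ys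

Valid-↭ : ∀ {Γ Δ} → Γ ↭ Δ → ValidEnv Γ → ValidEnv Δ
Valid-↭ π (uc , uq) = Unique-resp-↭ (concatMap-↭ cnames π) uc , Unique-resp-↭ (concatMap-↭ qnames π) uq

Valid-++⁻ : ∀ Γ Δ → ValidEnv (Γ ++ Δ) → ValidEnv Γ × ValidEnv Δ
Valid-++⁻ Γ Δ (uc , uq)
  with ucΓ , ucΔ , _ ← Unique-++⁻ (cvars Γ) (subst Unique (concatMap-++ cnames Γ Δ) uc)
  with uqΓ , uqΔ , _ ← Unique-++⁻ (qvars Γ) (subst Unique (concatMap-++ qnames Γ Δ) uq)
  = (ucΓ , uqΓ) , (ucΔ , uqΔ)

Valid-∷⁻ : ∀ i Γ → ValidEnv (i ∷ Γ) → Unique (cnames i) × All (_∉ cvars Γ) (cnames i) × ValidEnv Γ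
Valid-∷⁻ i Γ (uc , uq) with ui , uΓ , i∉Γ ← Unique-++⁻ (cnames i) uc =
  ui , i∉Γ , uΓ , proj₁ (proj₂ (Unique-++⁻ (qnames i) uq))

Valid-++-fresh : ∀ Δ {Γ} → Unique (cvars Δ) → qvars Δ ≡ [] → All (_∉ cvars Γ) (cvars Δ) → ValidEnv Γ →
                 ValidEnv (Δ ++ Γ)
Valid-++-fresh Δ {Γ} uΔ qΔ Δ∉Γ (uc , uq) =
  subst Unique (sym (concatMap-++ cnames Δ Γ)) (Unique-++⁺ uΔ uc Δ∉Γ) ,
  subst Unique (sym (trans (concatMap-++ qnames Δ Γ) (cong (_++ qvars Γ) qΔ))) uq

cvars-bangs : ∀ xs → cvars (bangs xs) ≡ xs
cvars-bangs []       = refl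
cvars-bangs (x ∷ xs) = cong (x ∷_) (cvars-bangs xs)

qvars-bangs : ∀ xs → qvars (bangs xs) ≡ []
qvars-bangs []       = refl
qvars-bangs (x ∷ xs) = qvars-bangs xs

cvars-pvars-++ : ∀ xs Γ → cvars (pvars xs ++ Γ) ≡ xs ++ cvars Γ
cvars-pvars-++ xs Γ = trans (concatMap-++ cnames (pvars xs) Γ) (cong (_++ cvars Γ) (cvars-pvars xs))

cvars-bangs-++ : ∀ xs Γ → cvars (bangs xs ++ Γ) ≡ xs ++ cvars Γ
cvars-bangs-++ xs Γ = trans (concatMap-++ cnames (bangs xs) Γ) (cong (_++ cvars Γ) (cvars-bangs xs))

Valid-pvars-++ : ∀ xs Γ → Unique xs → All (_∉ cvars Γ) xs → ValidEnv Γ → ValidEnv (pvars xs ++ Γ)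
Valid-pvars-++ xs Γ uxs = Valid-++-fresh (pvars xs) (subst Unique (sym (cvars-pvars xs)) uxs) (qvars-pvars xs)
                        ∘ subst (All _) (sym (cvars-pvars xs))

Valid-bangs-++ : ∀ xs Γ → Unique xs → All (_∉ cvars Γ) xs → ValidEnv Γ → ValidEnv (bangs xs ++ Γ)
Valid-bangs-++ xs Γ uxs = Valid-++-fresh (bangs xs) (subst Unique (sym (cvars-bangs xs)) uxs) (qvars-bangs xs)
                        ∘ subst (All _) (sym (cvars-bangs xs))

⊢-valid : ∀ {Γ M} → Γ ⊢ M → ValidEnv Γ
⊢-valid ax-c0                = [] , []
⊢-valid ax-c1                = [] , []
⊢-valid (ax-U i)             = [] , []
⊢-valid (ax-q r)             = [] , [] ∷ []
⊢-valid (ax-x x)             = [] ∷ [] , []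
⊢-valid (weak x d v)         = v
⊢-valid (contr x y z d v)    = v
⊢-valid (prom xs d)          = ⊢-valid d
⊢-valid (derel x d)          = ⊢-valid d
⊢-valid (tpat {Γ} x y xs d) with uc , uq ← ⊢-valid d =
  subst Unique (cvars-pvars-++ (x ∷ y ∷ xs) Γ) uc , subst Unique (qvars-pvars-++ (x ∷ y ∷ xs) Γ) uq
⊢-valid (tupI d₁ d₂ ds v)    = v
⊢-valid (newI d)             = ⊢-valid d
⊢-valid (lamV {Γ} x _ d)      = proj₂ (proj₂ (Valid-∷⁻ (pat (pvar x)) Γ (⊢-valid d)))
⊢-valid (lamT {Γ} x y xs _ d) = proj₂ (proj₂ (Valid-∷⁻ (pat (ptup x y xs)) Γ (⊢-valid d)))
⊢-valid (lamB {Γ} x _ d)      = proj₂ (proj₂ (Valid-∷⁻ (bang x) Γ (⊢-valid d)))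
⊢-valid (appI d₁ d₂ v)       = v
⊢-valid (exch d π)           = Valid-↭ π (⊢-valid d)

unrestrictedᵢ : Item → List ℕ
unrestrictedᵢ (bang x) = x ∷ []
unrestrictedᵢ _        = []

linearᵢ : Item → Env
linearᵢ (pat (pvar x))      = pat (pvar x) ∷ []
linearᵢ (pat (ptup x y xs)) = pvars (x ∷ y ∷ xs)
linearᵢ (bang x)            = []
linearᵢ (qit r)             = qit r ∷ []

unrestricted : Env → List ℕ
unrestricted = concatMap unrestrictedᵢ

linear : Env → Env
linear = concatMap linearᵢ

∉-cvars⇒∉-unrestricted : ∀ {x} Γ → x ∉ cvars Γ → x ∉ unrestricted Γ
∉-cvars⇒∉-unrestricted (bang y ∷ Γ)             x∉ (here refl) = x∉ (here refl)
∉-cvars⇒∉-unrestricted (bang y ∷ Γ)             x∉ (there p)   = ∉-cvars⇒∉-unrestricted Γ (x∉ ∘ there) p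
∉-cvars⇒∉-unrestricted (pat (pvar y) ∷ Γ)       x∉ p = ∉-cvars⇒∉-unrestricted Γ (x∉ ∘ there) p
∉-cvars⇒∉-unrestricted (pat (ptup y z ys) ∷ Γ)  x∉ p = ∉-cvars⇒∉-unrestricted Γ (x∉ ∘ ∈-++⁺ʳ (y ∷ z ∷ ys)) p
∉-cvars⇒∉-unrestricted (qit r ∷ Γ)              x∉ p = ∉-cvars⇒∉-unrestricted Γ x∉ p

cvars-linearᵢ : ∀ {x} i → x ∈ cvars (linearᵢ i) → x ∈ cnames i
cvars-linearᵢ (pat (pvar y))      p = p
cvars-linearᵢ {x} (pat (ptup y z ys)) p = subst (x ∈_) (cvars-pvars (y ∷ z ∷ ys)) p

∉-cvars⇒∉-linear : ∀ {x} Γ → x ∉ cvars Γ → x ∉ cvars (linear Γ)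
∉-cvars⇒∉-linear (i ∷ Γ) x∉ p with ∈-concatMap-++⁻ cnames (linearᵢ i) p
... | inj₁ q = x∉ (∈-++⁺ˡ (cvars-linearᵢ i q))
... | inj₂ q = ∉-cvars⇒∉-linear Γ (x∉ ∘ ∈-++⁺ʳ (cnames i)) q

Valid-∷⇒∉-translation : ∀ i Γ → ValidEnv (i ∷ Γ) →
                        Unique (cnames i) × All (_∉ unrestricted Γ) (cnames i) ×
                        All (_∉ cvars (linear Γ)) (cnames i)
Valid-∷⇒∉-translation i Γ v with uniq , i∉Γ , _ ← Valid-∷⁻ i Γ v =
  uniq , All.map (∉-cvars⇒∉-unrestricted Γ) i∉Γ , All.map (∉-cvars⇒∉-linear Γ) i∉Γ

unrestricted-pvars-++ : ∀ xs Γ → unrestricted (pvars xs ++ Γ) ≡ unrestricted Γ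
unrestricted-pvars-++ []       Γ = refl
unrestricted-pvars-++ (x ∷ xs) Γ = unrestricted-pvars-++ xs Γ

linear-pvars-++ : ∀ xs Γ → linear (pvars xs ++ Γ) ≡ pvars xs ++ linear Γ
linear-pvars-++ []       Γ = refl
linear-pvars-++ (x ∷ xs) Γ = cong (pat (pvar x) ∷_) (linear-pvars-++ xs Γ)

linear-bangs : ∀ xs → linear (bangs xs) ≡ []
linear-bangs []       = refl
linear-bangs (x ∷ xs) = linear-bangs xs

linear-concat : ∀ Γs → linear (concat Γs) ≡ concat (map linear Γs)
linear-concat []       = refl
linear-concat (Γ ∷ Γs) = trans (concatMap-++ linearᵢ Γ (concat Γs)) (cong (linear Γ ++_) (linear-concat Γs))

mutual
  ⊢⇒⊩ : ∀ {Γ M} → Γ ⊢ M → unrestricted Γ ∣ linear Γ ⊩ M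
  ⊢⇒⊩ ax-c0    = ⊩c0
  ⊢⇒⊩ ax-c1    = ⊩c1
  ⊢⇒⊩ (ax-U i) = ⊩U i
  ⊢⇒⊩ (ax-q r) = ⊩qv r
  ⊢⇒⊩ (ax-x x) = ⊩lin x
  ⊢⇒⊩ (weak {Γ} x d _) = ⊩-weaken (xs⊆x∷xs (unrestricted Γ) x) (⊢⇒⊩ d)
  ⊢⇒⊩ (contr {Γ} {M} x y z d _)
    with _ , _ , x∉Λ ∷ [] ← Valid-∷⇒∉-translation (bang x) (bang y ∷ Γ) (⊢-valid d)
    with _ , _ , y∉Λ ∷ [] ←
         Valid-∷⇒∉-translation (bang y) Γ (proj₂ (Valid-++⁻ (bang x ∷ []) (bang y ∷ Γ) (⊢-valid d)))
    = subst (z ∷ unrestricted Γ ∣ linear Γ ⊩_) renamings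
        (⊩-subst-unr (⊩-subst-unr (⊢⇒⊩ d) (∷⁺ʳ x (∷⁺ʳ y (xs⊆x∷xs _ z))) x∉Λ (⊩unr z (there (here refl))))
                     ⊆-refl y∉Λ (⊩unr z (here refl)))
    where
    renamings : substVars (y ↦ var z) (substVars (x ↦ var z) M) ≡ ren y z (ren x z M)
    renamings = trans (cong (substVars (y ↦ var z)) (sym (ren≡substVars x z M)))
                      (sym (ren≡substVars y z (ren x z M)))
  ⊢⇒⊩ (prom {M} xs d) =
    subst (unrestricted (bangs xs) ∣_⊩ ! M) (sym (linear-bangs xs))
      (⊩! (subst (unrestricted (bangs xs) ∣_⊩ M) (linear-bangs xs) (⊢⇒⊩ d)))
  ⊢⇒⊩ (derel {Γ} x d) with _ , x∉Θ ∷ [] , x∉Λ ∷ [] ← Valid-∷⇒∉-translation (pat (pvar x)) Γ (⊢-valid d) =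
    ⊩-derelict (⊢⇒⊩ d) ⊆-refl x∉Θ x∉Λ
  ⊢⇒⊩ (tpat {Γ} {M} x y xs d) =
    subst₂ (_∣_⊩ M) (unrestricted-pvars-++ (x ∷ y ∷ xs) Γ) (linear-pvars-++ (x ∷ y ∷ xs) Γ) (⊢⇒⊩ d)
  ⊢⇒⊩ (tupI {Γ₁} {Γ₂} {Γs} {M₁} {M₂} {Ms} d₁ d₂ ds _) =
    subst (unrestricted (Γ₁ ++ Γ₂ ++ concat Γs) ∣_⊩ tup M₁ M₂ Ms) (sym (linear-concat (Γ₁ ∷ Γ₂ ∷ Γs)))
      (⊩tup (⊩-weaken (∈-concatMap-++⁺ˡ unrestrictedᵢ Γ₁ (Γ₂ ++ concat Γs)) (⊢⇒⊩ d₁)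
           ∷ ⊩-weaken (∈-concatMap-++⁺ʳ unrestrictedᵢ Γ₁ ∘ ∈-concatMap-++⁺ˡ unrestrictedᵢ Γ₂ (concat Γs))
                      (⊢⇒⊩ d₂)
           ∷ ⊢⇒⊩* ds (∈-concatMap-++⁺ʳ unrestrictedᵢ Γ₁ ∘ ∈-concatMap-++⁺ʳ unrestrictedᵢ Γ₂)))
  ⊢⇒⊩ (newI d) = ⊩new (⊢⇒⊩ d)
  ⊢⇒⊩ (lamV {Γ} {M} x x∉M d)
    with _ , x∉Θ ∷ [] , x∉Λ ∷ [] ← Valid-∷⇒∉-translation (pat (pvar x)) Γ (⊢-valid d) =
    ⊩ƛv _ (⊩-openings-intro {M = M} (x ∷ []) (⊢⇒⊩ d) ([] ∷ []) (x∉Θ ∷ []) (x∉Λ ∷ []) (x∉M ∷ []))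
  ⊢⇒⊩ (lamT {Γ} {M} x y xs xs∉M d)
    with uniq , xs∉Θ , xs∉Λ ← Valid-∷⇒∉-translation (pat (ptup x y xs)) Γ (⊢-valid d)
    = ⊩ƛt (length xs) _ (⊩-openings-intro {M = M} (x ∷ y ∷ xs) (⊢⇒⊩ d) uniq xs∉Θ xs∉Λ xs∉M)
  ⊢⇒⊩ (lamB {Γ} x x∉M d) with _ , _ , x∉Λ ∷ [] ← Valid-∷⇒∉-translation (bang x) Γ (⊢-valid d) =
    ⊩ƛ!-intro x (⊢⇒⊩ d) x∉Λ x∉M
  ⊢⇒⊩ (appI {Γ₁} {Γ₂} {M₁} {M₂} d₁ d₂ _) =
    subst₂ (_∣_⊩ M₁ · M₂) (sym (concatMap-++ unrestrictedᵢ Γ₁ Γ₂)) (sym (concatMap-++ linearᵢ Γ₁ Γ₂))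
      (⊩app (⊩-weaken (xs⊆xs++ys _ _) (⊢⇒⊩ d₁)) (⊩-weaken (xs⊆ys++xs _ _) (⊢⇒⊩ d₂)))
  ⊢⇒⊩ (exch d π) = ⊩exch (⊩-weaken (∈-resp-↭ (concatMap-↭ unrestrictedᵢ π)) (⊢⇒⊩ d)) (concatMap-↭ linearᵢ π)

  ⊢⇒⊩* : ∀ {Γs Ms Θ} → Pointwise _⊢_ Γs Ms → unrestricted (concat Γs) ⊆ Θ → Θ ∣ map linear Γs ⊩* Ms
  ⊢⇒⊩* []                  _ = []
  ⊢⇒⊩* {Γ ∷ Γs} (d ∷ ds) h =
    ⊩-weaken (h ∘ ∈-concatMap-++⁺ˡ unrestrictedᵢ Γ (concat Γs)) (⊢⇒⊩ d) ∷
    ⊢⇒⊩* ds (h ∘ ∈-concatMap-++⁺ʳ unrestrictedᵢ Γ)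

renameᵢ : (ℕ → ℕ) → Item → Item
renameᵢ ρ (pat (pvar x))      = pat (pvar (ρ x))
renameᵢ ρ (pat (ptup x y xs)) = pat (ptup (ρ x) (ρ y) (map ρ xs))
renameᵢ ρ (bang x)            = bang (ρ x)
renameᵢ ρ (qit r)             = qit r

renameᴱ : (ℕ → ℕ) → Env → Env
renameᴱ ρ = map (renameᵢ ρ)

cnames-renameᵢ : ∀ ρ i → cnames (renameᵢ ρ i) ≡ map ρ (cnames i)
cnames-renameᵢ ρ (pat (pvar x))      = refl
cnames-renameᵢ ρ (pat (ptup x y xs)) = refl
cnames-renameᵢ ρ (bang x)            = refl
cnames-renameᵢ ρ (qit r)             = refl

qnames-renameᵢ : ∀ ρ i → qnames (renameᵢ ρ i) ≡ qnames i
qnames-renameᵢ ρ (pat (pvar x))      = refl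
qnames-renameᵢ ρ (pat (ptup x y xs)) = refl
qnames-renameᵢ ρ (bang x)            = refl
qnames-renameᵢ ρ (qit r)             = refl

cvars-renameᴱ : ∀ ρ Γ → cvars (renameᴱ ρ Γ) ≡ map ρ (cvars Γ)
cvars-renameᴱ ρ []      = refl
cvars-renameᴱ ρ (i ∷ Γ) =
  trans (cong₂ _++_ (cnames-renameᵢ ρ i) (cvars-renameᴱ ρ Γ)) (sym (map-++ ρ (cnames i) (cvars Γ)))

qvars-renameᴱ : ∀ ρ Γ → qvars (renameᴱ ρ Γ) ≡ qvars Γ
qvars-renameᴱ ρ []      = refl
qvars-renameᴱ ρ (i ∷ Γ) = cong₂ _++_ (qnames-renameᵢ ρ i) (qvars-renameᴱ ρ Γ)

Valid-renameᴱ : ∀ {ρ} → Injective _≡_ _≡_ ρ → ∀ Γ → ValidEnv Γ → ValidEnv (renameᴱ ρ Γ)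
Valid-renameᴱ {ρ} inj Γ (uc , uq) =
  subst Unique (sym (cvars-renameᴱ ρ Γ)) (Unique.map⁺ inj uc) , subst Unique (sym (qvars-renameᴱ ρ Γ)) uq

renameᴱ-bangs : ∀ ρ xs → renameᴱ ρ (bangs xs) ≡ bangs (map ρ xs)
renameᴱ-bangs ρ []       = refl
renameᴱ-bangs ρ (x ∷ xs) = cong (bang (ρ x) ∷_) (renameᴱ-bangs ρ xs)

renameᴱ-pvars : ∀ ρ xs → renameᴱ ρ (pvars xs) ≡ pvars (map ρ xs)
renameᴱ-pvars ρ []       = refl
renameᴱ-pvars ρ (x ∷ xs) = cong (pat (pvar (ρ x)) ∷_) (renameᴱ-pvars ρ xs)

renameᴱ-fixed : ∀ ρ Γ → (∀ {x} → x ∈ cvars Γ → ρ x ≡ x) → renameᴱ ρ Γ ≡ Γ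
renameᴱ-fixed ρ []      _     = refl
renameᴱ-fixed ρ (i ∷ Γ) fixed =
  cong₂ _∷_ (item i (fixed ∘ ∈-++⁺ˡ)) (renameᴱ-fixed ρ Γ (fixed ∘ ∈-++⁺ʳ (cnames i)))
  where
  names : ∀ xs → (∀ {x} → x ∈ xs → ρ x ≡ x) → map ρ xs ≡ xs
  names []       _ = refl
  names (x ∷ xs) h = cong₂ _∷_ (h (here refl)) (names xs (h ∘ there))
  item : ∀ i → (∀ {x} → x ∈ cnames i → ρ x ≡ x) → renameᵢ ρ i ≡ i
  item (pat (pvar x))      h = cong (pat ∘ pvar) (h (here refl))
  item (pat (ptup x y xs)) h = cong₃ (λ a b cs → pat (ptup a b cs)) (h (here refl)) (h (there (here refl)))
                                     (names xs (h ∘ there ∘ there))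
  item (bang x)            h = cong bang (h (here refl))
  item (qit r)             h = refl

map-rename-vars : ∀ ρ xs → map (rename ρ) (map var xs) ≡ map var (map ρ xs)
map-rename-vars ρ []       = refl
map-rename-vars ρ (x ∷ xs) = cong (var (ρ x) ∷_) (map-rename-vars ρ xs)

module _ {ρ : ℕ → ℕ} (inj : Injective _≡_ _≡_ ρ) where

  rename-open-vars : ∀ xs M → rename ρ (open0 (map var xs) M) ≡ open0 (map var (map ρ xs)) (rename ρ M)
  rename-open-vars xs M =
    trans (rename-inst ρ 0 (map var xs) M) (cong (λ us → open0 us (rename ρ M)) (map-rename-vars ρ xs))

  mutual
    ⊢-rename : ∀ {Γ M} → Γ ⊢ M → renameᴱ ρ Γ ⊢ rename ρ M
    ⊢-rename ax-c0    = ax-c0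
    ⊢-rename ax-c1    = ax-c1
    ⊢-rename (ax-U i) = ax-U i
    ⊢-rename (ax-q r) = ax-q r
    ⊢-rename (ax-x x) = ax-x (ρ x)
    ⊢-rename (weak {Γ} x d v) = weak (ρ x) (⊢-rename d) (Valid-renameᴱ inj (bang x ∷ Γ) v)
    ⊢-rename (contr {Γ} {M} x y z d v) =
      subst (bang (ρ z) ∷ renameᴱ ρ Γ ⊢_)
            (sym (trans (rename-ren inj y z (ren x z M)) (cong (ren (ρ y) (ρ z)) (rename-ren inj x z M))))
            (contr (ρ x) (ρ y) (ρ z) (⊢-rename d) (Valid-renameᴱ inj (bang z ∷ Γ) v))
    ⊢-rename (prom {M} xs d) =
      subst (_⊢ ! rename ρ M) (sym (renameᴱ-bangs ρ xs))
            (prom (map ρ xs) (subst (_⊢ rename ρ M) (renameᴱ-bangs ρ xs) (⊢-rename d)))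
    ⊢-rename (derel x d) = derel (ρ x) (⊢-rename d)
    ⊢-rename (tpat {Γ} {M} x y xs d) =
      tpat (ρ x) (ρ y) (map ρ xs)
        (subst (_⊢ rename ρ M) (trans (map-++ (renameᵢ ρ) (pvars (x ∷ y ∷ xs)) Γ)
                                      (cong (_++ renameᴱ ρ Γ) (renameᴱ-pvars ρ (x ∷ y ∷ xs))))
               (⊢-rename d))
    ⊢-rename (tupI {Γ₁} {Γ₂} {Γs} {M₁} {M₂} {Ms} d₁ d₂ ds v) =
      subst (_⊢ rename ρ (tup M₁ M₂ Ms)) (sym split)
        (tupI (⊢-rename d₁) (⊢-rename d₂) (⊢-rename* ds)
              (subst ValidEnv split (Valid-renameᴱ inj (Γ₁ ++ Γ₂ ++ concat Γs) v)))
      where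
      split : renameᴱ ρ (Γ₁ ++ Γ₂ ++ concat Γs) ≡ renameᴱ ρ Γ₁ ++ renameᴱ ρ Γ₂ ++ concat (map (renameᴱ ρ) Γs)
      split = trans (map-++ (renameᵢ ρ) Γ₁ _)
                    (cong (renameᴱ ρ Γ₁ ++_) (trans (map-++ (renameᵢ ρ) Γ₂ _)
                                                    (cong (renameᴱ ρ Γ₂ ++_) (sym (concat-map Γs)))))
    ⊢-rename (newI d) = newI (⊢-rename d)
    ⊢-rename (lamV {Γ} {M} x x∉M d) =
      lamV (ρ x) (∉-fv-rename inj M x∉M)
           (subst (pat (pvar (ρ x)) ∷ renameᴱ ρ Γ ⊢_) (rename-open-vars (x ∷ []) M) (⊢-rename d))
    ⊢-rename (lamT {Γ} {M} x y xs xs∉M d) =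
      subst (λ k → renameᴱ ρ Γ ⊢ ƛt k (rename ρ M)) (length-map ρ xs)
        (lamT (ρ x) (ρ y) (map ρ xs) (AllP.map⁺ (All.map (∉-fv-rename inj M) xs∉M))
              (subst (renameᴱ ρ (pat (ptup x y xs) ∷ Γ) ⊢_) (rename-open-vars (x ∷ y ∷ xs) M) (⊢-rename d)))
    ⊢-rename (lamB {Γ} {M} x x∉M d) =
      lamB (ρ x) (∉-fv-rename inj M x∉M)
           (subst (bang (ρ x) ∷ renameᴱ ρ Γ ⊢_) (rename-open-vars (x ∷ []) M) (⊢-rename d))
    ⊢-rename (appI {Γ₁} {Γ₂} {M₁} {M₂} d₁ d₂ v) =
      subst (_⊢ rename ρ (M₁ · M₂)) (sym (map-++ (renameᵢ ρ) Γ₁ Γ₂))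
        (appI (⊢-rename d₁) (⊢-rename d₂)
              (subst ValidEnv (map-++ (renameᵢ ρ) Γ₁ Γ₂) (Valid-renameᴱ inj (Γ₁ ++ Γ₂) v)))
    ⊢-rename (exch d π) = exch (⊢-rename d) (map⁺ (renameᵢ ρ) π)

    ⊢-rename* : ∀ {Γs Ms} → Pointwise _⊢_ Γs Ms → Pointwise _⊢_ (map (renameᴱ ρ) Γs) (substVarsL (var ∘ ρ) Ms)
    ⊢-rename* []       = []
    ⊢-rename* (d ∷ ds) = ⊢-rename d ∷ ⊢-rename* ds

renMany : List ℕ → ℕ → Term → Term
renMany []       s M = M
renMany (c ∷ cs) s M = ren c s (renMany cs s M)

renMany-fresh : ∀ cs s M → All (_∉ fv M) cs → renMany cs s M ≡ M
renMany-fresh []       s M []            = refl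
renMany-fresh (c ∷ cs) s M (c∉M ∷ cs∉M) = trans (cong (ren c s) (renMany-fresh cs s M cs∉M)) (ren-fresh s M c∉M)

renMany-transpose : ∀ {c} cs s M → c ∈ cs → Unique cs → All (_∉ fv M) cs → s ∉ cs →
                    renMany cs s (rename (transpose s c) M) ≡ M
renMany-transpose (c ∷ cs) s M (here refl) (c∉cs ∷ _) (c∉M ∷ cs∉M) s∉ =
  trans (cong (ren c s) (renMany-fresh cs s (rename (transpose s c) M) cs∉τM)) (ren-transpose s c M c∉M)
  where
  cs∉τM : All (_∉ fv (rename (transpose s c) M)) cs
  cs∉τM = All.tabulate λ {c′} c′∈cs →
    subst (_∉ fv (rename (transpose s c) M))
          (transpose-other (λ { refl → s∉ (there c′∈cs) }) (λ c′≡c → All.lookup c∉cs c′∈cs (sym c′≡c)))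
          (∉-fv-rename (transpose-injective s c) M (All.lookup cs∉M c′∈cs))
renMany-transpose (c′ ∷ cs) s M (there c∈cs) (_ ∷ u) (c′∉M ∷ cs∉M) s∉ =
  trans (cong (ren c′ s) (renMany-transpose cs s M c∈cs u cs∉M (s∉ ∘ there))) (ren-fresh s M c′∉M)

⊢-contract* : ∀ s cs {Γ M} → bangs cs ++ Γ ⊢ M → ValidEnv (bang s ∷ Γ) → Unique cs → All (_∉ s ∷ cvars Γ) cs →
              bang s ∷ Γ ⊢ renMany cs s M
⊢-contract* s []       d v _ _ = weak s d v
⊢-contract* s (c ∷ cs) {Γ} {M} d v (c∉cs ∷ uniq) (c∉ ∷ cs∉) =
  subst (λ t → bang s ∷ Γ ⊢ ren c s t) (ren-self s (renMany cs s M))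
    (contr s c s (⊢-contract* s cs (exch d (↭-sym (shift (bang c) (bangs cs) Γ))) vsc uniq cs∉′) v)
  where
  s∉Γ : s ∉ cvars Γ
  s∉Γ = All.lookup (proj₁ (proj₂ (Valid-∷⁻ (bang s) Γ v))) (here refl)
  vsc : ValidEnv (bang s ∷ bang c ∷ Γ)
  vsc = Valid-bangs-++ (s ∷ c ∷ []) Γ (((λ { refl → c∉ (here refl) }) ∷ []) ∷ [] ∷ []) (s∉Γ ∷ (c∉ ∘ there) ∷ [])
                       (proj₂ (Valid-++⁻ (bang s ∷ []) Γ v))
  cs∉′ : All (_∉ s ∷ c ∷ cvars Γ) cs
  cs∉′ = All.zipWith (λ (c≢c′ , c′∉) → λ { (here refl) → c′∉ (here refl)
                                          ; (there (here refl)) → c≢c′ refl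
                                          ; (there (there p)) → c′∉ (there p) })
                     (c∉cs , cs∉)

⊢-rename-apart : ∀ s c S {Γ M} → bang s ∷ bangs S ++ Γ ⊢ M → s ∉ S ++ cvars Γ → c ∉ S ++ cvars Γ →
                 bangs S ++ bang c ∷ Γ ⊢ rename (transpose s c) M
⊢-rename-apart s c S {Γ} {M} d s∉ c∉ =
  exch (subst₂ (λ a Δ → bang a ∷ Δ ⊢ rename (transpose s c) M)
               (transpose-left s c) (renameᴱ-fixed _ (bangs S ++ Γ) fixed)
               (⊢-rename (transpose-injective s c) d))
       (↭-sym (shift (bang c) (bangs S) Γ))
  where
  fixed : ∀ {x} → x ∈ cvars (bangs S ++ Γ) → transpose s c x ≡ x
  fixed {x} p with p′ ← subst (x ∈_) (cvars-bangs-++ S Γ) p =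
    transpose-other (λ { refl → s∉ p′ }) (λ { refl → c∉ p′ })

Shared : List ℕ → List Env → List Term → Set
Shared S = Pointwise (λ Γ M → bangs S ++ Γ ⊢ M)

renamedApart : ℕ → List ℕ → List Term → List Term
renamedApart s = zipWith (λ c M → rename (transpose s c) M)

separatedEnvs : List ℕ → List Env → List Env
separatedEnvs = zipWith (λ c Γ → bang c ∷ Γ)

separate : ∀ s S cs {Γs Ms} → Shared (s ∷ S) Γs Ms →
           s ∉ S ++ cvars (concat Γs) → All (_∉ S ++ cvars (concat Γs)) cs →
           Shared S (separatedEnvs cs Γs) (renamedApart s cs Ms)
separate s S []       _                    _  _ = []
separate s S (c ∷ cs) []                   _  _ = []
separate s S (c ∷ cs) {Γ ∷ Γs} (d ∷ ds) s∉ (c∉ ∷ cs∉) =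
  ⊢-rename-apart s c S d (narrow s∉) (narrow c∉) ∷ separate s S cs ds (widen s∉) (All.map widen cs∉)
  where
  narrow : ∀ {x} → x ∉ S ++ cvars (Γ ++ concat Γs) → x ∉ S ++ cvars Γ
  narrow x∉ p with ∈-++⁻ S p
  ... | inj₁ q = x∉ (∈-++⁺ˡ q)
  ... | inj₂ q = x∉ (∈-++⁺ʳ S (∈-concatMap-++⁺ˡ cnames Γ (concat Γs) q))
  widen : ∀ {x} → x ∉ S ++ cvars (Γ ++ concat Γs) → x ∉ S ++ cvars (concat Γs)
  widen x∉ p with ∈-++⁻ S p
  ... | inj₁ q = x∉ (∈-++⁺ˡ q)
  ... | inj₂ q = x∉ (∈-++⁺ʳ S (∈-concatMap-++⁺ʳ cnames Γ q))

concat-separatedEnvs : ∀ cs Γs → length cs ≡ length Γs → concat (separatedEnvs cs Γs) ↭ bangs cs ++ concat Γs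
concat-separatedEnvs []       []       _   = ↭-refl
concat-separatedEnvs (c ∷ cs) (Γ ∷ Γs) len =
  ↭-prep (bang c) (↭-trans (++⁺ˡ Γ (concat-separatedEnvs cs Γs (suc-injective len))) (shifts Γ (bangs cs)))

length-renamedApart : ∀ s cs Ms → length cs ≡ length Ms → length (renamedApart s cs Ms) ≡ length Ms
length-renamedApart s []       []       _   = refl
length-renamedApart s (c ∷ cs) (M ∷ Ms) len = cong suc (length-renamedApart s cs Ms (suc-injective len))

renMany-renamedApart : ∀ {s cs} → Unique cs → s ∉ cs → ∀ ds Ms → length ds ≡ length Ms → All (_∈ cs) ds →
                       All (_∉ fvL Ms) cs → map (renMany cs s) (renamedApart s ds Ms) ≡ Ms
renMany-renamedApart uniq s∉ []       []       _   _             _     = refl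
renMany-renamedApart {s} {cs} uniq s∉ (d ∷ ds) (M ∷ Ms) len (d∈ ∷ ds∈) cs∉MMs =
  cong₂ _∷_ (renMany-transpose cs s M d∈ uniq (All.map ∉-++⁻ˡ cs∉MMs) s∉)
            (renMany-renamedApart uniq s∉ ds Ms (suc-injective len) ds∈ (All.map (∉-++⁻ʳ (fv M)) cs∉MMs))

module Sharing (K : List Term → Term) (n : ℕ)
  (K-rule : ∀ {Γs Ms} → length Ms ≡ n → Pointwise _⊢_ Γs Ms → ValidEnv (concat Γs) → concat Γs ⊢ K Ms)
  (K-ren : ∀ a b Ms → ren a b (K Ms) ≡ K (map (ren a b) Ms)) where

  K-renMany : ∀ cs s Ms → renMany cs s (K Ms) ≡ K (map (renMany cs s) Ms)
  K-renMany []       s Ms = cong K (sym (map-id Ms))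
  K-renMany (c ∷ cs) s Ms =
    trans (cong (ren c s) (K-renMany cs s Ms)) (trans (K-ren c s _) (cong K (sym (map-∘ Ms))))

  -- Each premise gets its own fresh copy of s, the rule is applied, and the copies are contracted into s.
  share : ∀ S {Γs Ms} → length Ms ≡ n → Shared S Γs Ms → ValidEnv (bangs S ++ concat Γs) →
          bangs S ++ concat Γs ⊢ K Ms
  share []      len ds v = K-rule len ds v
  share (s ∷ S) {Γs} {Ms} len ds v
    with cs , len-cs , uniq , cs∉s ∷ cs∉SΓs ∷ cs∉Ms ∷ [] ←
         fresh-names (length Ms) ((s ∷ []) ∷ (S ++ cvars (concat Γs)) ∷ fvL Ms ∷ [])
    = subst (bang s ∷ Γ ⊢_) (trans (K-renMany cs s _) (cong K (renMany-renamedApart uniq s∉cs cs Ms len-cs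
                                                                   (All.tabulate (λ p → p)) cs∉Ms)))
        (⊢-contract* s cs (exch (share S (trans (length-renamedApart s cs Ms len-cs) len)
                                        (separate s S cs ds s∉SΓs cs∉SΓs) v′) π)
                     v uniq cs∉)
    where
    Γ : Env
    Γ = bangs S ++ concat Γs
    s∉SΓs : s ∉ S ++ cvars (concat Γs)
    s∉SΓs = subst (s ∉_) (cvars-bangs-++ S (concat Γs))
                  (All.lookup (proj₁ (proj₂ (Valid-∷⁻ (bang s) Γ v))) (here refl))
    s∉cs : s ∉ cs
    s∉cs s∈cs = All.lookup cs∉s s∈cs (here refl)
    cs∉ : All (_∉ s ∷ cvars Γ) cs
    cs∉ = All.zipWith (λ (c∉s , c∉SΓs) → λ { (here refl) → c∉s (here refl)
                                            ; (there p) → c∉SΓs (subst (_ ∈_) (cvars-bangs-++ S (concat Γs)) p) })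
                      (cs∉s , cs∉SΓs)
    π : bangs S ++ concat (separatedEnvs cs Γs) ↭ bangs cs ++ Γ
    π = ↭-trans (++⁺ˡ (bangs S) (concat-separatedEnvs cs Γs (trans len-cs (sym (Pointwise-length ds)))))
                (shifts (bangs S) (bangs cs))
    v′ : ValidEnv (bangs S ++ concat (separatedEnvs cs Γs))
    v′ = Valid-↭ (↭-sym π)
                 (Valid-bangs-++ cs Γ uniq (All.map (_∘ there) cs∉) (proj₂ (Valid-++⁻ (bang s ∷ []) Γ v)))

-- appOf and tupOf are only used on lists of length 2 and ≥ 2 respectively; c0 is a junk value.
appOf : List Term → Term
appOf (M ∷ N ∷ []) = M · N
appOf _            = c0

appOf-rule : ∀ {Γs Ms} → length Ms ≡ 2 → Pointwise _⊢_ Γs Ms → ValidEnv (concat Γs) → concat Γs ⊢ appOf Ms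
appOf-rule _ (_∷_ {x = Γ₁} d₁ (_∷_ {x = Γ₂} d₂ [])) v =
  subst (λ Δ → Γ₁ ++ Δ ⊢ _) (sym (++-identityʳ Γ₂))
        (appI d₁ d₂ (subst (λ Δ → ValidEnv (Γ₁ ++ Δ)) (++-identityʳ Γ₂) v))
appOf-rule () []
appOf-rule () (_ ∷ [])
appOf-rule () (_ ∷ _ ∷ _ ∷ _)

appOf-ren : ∀ a b Ms → ren a b (appOf Ms) ≡ appOf (map (ren a b) Ms)
appOf-ren a b []               = refl
appOf-ren a b (M ∷ [])         = refl
appOf-ren a b (M ∷ N ∷ [])     = refl
appOf-ren a b (M ∷ N ∷ P ∷ Ms) = refl

tupOf : List Term → Term
tupOf (M ∷ N ∷ Ms) = tup M N Ms
tupOf _            = c0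

tupOf-rule : ∀ k {Γs Ms} → length Ms ≡ suc (suc k) → Pointwise _⊢_ Γs Ms → ValidEnv (concat Γs) →
             concat Γs ⊢ tupOf Ms
tupOf-rule k _  (d₁ ∷ d₂ ∷ ds) v = tupI d₁ d₂ ds v
tupOf-rule k () []
tupOf-rule k () (_ ∷ [])

renL≡map-ren : ∀ a b Ms → renL a b Ms ≡ map (ren a b) Ms
renL≡map-ren a b []       = refl
renL≡map-ren a b (M ∷ Ms) = cong (ren a b M ∷_) (renL≡map-ren a b Ms)

tupOf-ren : ∀ a b Ms → ren a b (tupOf Ms) ≡ tupOf (map (ren a b) Ms)
tupOf-ren a b []           = refl
tupOf-ren a b (M ∷ [])     = refl
tupOf-ren a b (M ∷ N ∷ Ms) = cong (tup (ren a b M) (ren a b N)) (renL≡map-ren a b Ms)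

-- From Θ ∣ Λ ⊩ M back to Γ ⊢ M

⊢-weaken-bangs : ∀ xs {Γ M} → Γ ⊢ M → ValidEnv (bangs xs ++ Γ) → bangs xs ++ Γ ⊢ M
⊢-weaken-bangs []       d v = d
⊢-weaken-bangs (x ∷ xs) {Γ} d v =
  weak x (⊢-weaken-bangs xs d (proj₂ (Valid-++⁻ (bang x ∷ []) (bangs xs ++ Γ) v))) v

⊢-lamT : ∀ {Γ M n} xs → length xs ≡ suc (suc n) → All (_∉ fv M) xs → pvars xs ++ Γ ⊢ open0 (map var xs) M →
         Γ ⊢ ƛt n M
⊢-lamT (x ∷ y ∷ zs) refl xs∉M d = lamT x y zs xs∉M (tpat x y zs d)

Valid-++-take : ∀ A B C → ValidEnv (A ++ B ++ C) → ValidEnv (A ++ B)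
Valid-++-take A B C v = proj₁ (Valid-++⁻ (A ++ B) C (subst ValidEnv (sym (++-assoc A B C)) v))

Valid-++-drop : ∀ A B C → ValidEnv (A ++ B ++ C) → ValidEnv (A ++ C)
Valid-++-drop A B C v = proj₂ (Valid-++⁻ B (A ++ C) (Valid-↭ (shifts A B) v))

∉-cvars-bangs-++ : ∀ {x} Θ Λ → x ∉ Θ → x ∉ cvars Λ → x ∉ cvars (bangs Θ ++ Λ)
∉-cvars-bangs-++ {x} Θ Λ x∉Θ x∉Λ = subst (x ∉_) (sym (cvars-bangs-++ Θ Λ)) (∉-++⁺ Θ x∉Θ x∉Λ)

bangs-extract : ∀ A x B → bangs (A ++ B) ++ bang x ∷ [] ↭ bangs (A ++ x ∷ B) ++ []
bangs-extract A x B = begin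
  bangs (A ++ B) ++ bang x ∷ []  ↭⟨ ++-comm (bangs (A ++ B)) (bang x ∷ []) ⟩
  bang x ∷ bangs (A ++ B)        ≡⟨ cong (bang x ∷_) (map-++ bang A B) ⟩
  bang x ∷ bangs A ++ bangs B    ↭⟨ shift (bang x) (bangs A) (bangs B) ⟨
  bangs A ++ bang x ∷ bangs B    ≡⟨ map-++ bang A (x ∷ B) ⟨
  bangs (A ++ x ∷ B)             ≡⟨ ++-identityʳ _ ⟨
  bangs (A ++ x ∷ B) ++ []       ∎
  where open PermutationReasoning

mutual
  ⊩⇒⊢ : ∀ {Θ Λ M} → Θ ∣ Λ ⊩ M → ValidEnv (bangs Θ ++ Λ) → bangs Θ ++ Λ ⊢ M
  ⊩⇒⊢ {Θ} ⊩c0     v = ⊢-weaken-bangs Θ ax-c0 v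
  ⊩⇒⊢ {Θ} ⊩c1     v = ⊢-weaken-bangs Θ ax-c1 v
  ⊩⇒⊢ {Θ} (⊩U i)  v = ⊢-weaken-bangs Θ (ax-U i) v
  ⊩⇒⊢ {Θ} (⊩qv r) v = ⊢-weaken-bangs Θ (ax-q r) v
  ⊩⇒⊢ {Θ} (⊩lin x) v = ⊢-weaken-bangs Θ (ax-x x) v
  ⊩⇒⊢ (⊩unr x x∈Θ) v with A , B , refl ← ∈-∃++ x∈Θ =
    exch (⊢-weaken-bangs (A ++ B) (derel x (ax-x x)) (Valid-↭ (↭-sym (bangs-extract A x B)) v))
         (bangs-extract A x B)
  ⊩⇒⊢ {Θ} (⊩! {M = M} d) v =
    subst (_⊢ ! M) (sym (++-identityʳ (bangs Θ))) (prom Θ (subst (_⊢ M) (++-identityʳ (bangs Θ)) (⊩⇒⊢ d v)))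
  ⊩⇒⊢ (⊩new d) v = newI (⊩⇒⊢ d v)
  ⊩⇒⊢ {Θ} (⊩app {Λ₁ = Λ₁} {Λ₂} {M} {N} d e) v =
    subst (λ Δ → bangs Θ ++ Λ₁ ++ Δ ⊢ M · N) (++-identityʳ Λ₂)
      (Sharing.share appOf 2 appOf-rule appOf-ren Θ refl
        (⊩⇒⊢ d (Valid-++-take (bangs Θ) Λ₁ Λ₂ v) ∷ ⊩⇒⊢ e (Valid-++-drop (bangs Θ) Λ₁ Λ₂ v) ∷ [])
        (subst (λ Δ → ValidEnv (bangs Θ ++ Λ₁ ++ Δ)) (sym (++-identityʳ Λ₂)) v))
  ⊩⇒⊢ {Θ} (⊩tup {Ms = Ms} ds) v =
    Sharing.share tupOf (suc (suc (length Ms))) (tupOf-rule (length Ms)) tupOf-ren Θ refl (⊩⇒⊢* ds v) v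
  ⊩⇒⊢ {Θ} {Λ} (⊩ƛv {M = M} L f) v
    with x , x∉L ∷ x∉Θ ∷ x∉Λ ∷ x∉M ∷ [] ← fresh-name (L ∷ Θ ∷ cvars Λ ∷ fv M ∷ [])
    = lamV x x∉M (exch (⊩⇒⊢ (f (x ∷ []) refl ([] ∷ []) (x∉L ∷ [])) (Valid-↭ (↭-sym π) vx)) π)
    where
    π : bangs Θ ++ pat (pvar x) ∷ Λ ↭ pat (pvar x) ∷ bangs Θ ++ Λ
    π = shift (pat (pvar x)) (bangs Θ) Λ
    vx : ValidEnv (pat (pvar x) ∷ bangs Θ ++ Λ)
    vx = Valid-pvars-++ (x ∷ []) (bangs Θ ++ Λ) ([] ∷ []) (∉-cvars-bangs-++ Θ Λ x∉Θ x∉Λ ∷ []) v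
  ⊩⇒⊢ {Θ} {Λ} (⊩ƛt {M = M} n L f) v
    with xs , len , uniq , xs∉L ∷ xs∉Θ ∷ xs∉Λ ∷ xs∉M ∷ [] ←
         fresh-names (suc (suc n)) (L ∷ Θ ∷ cvars Λ ∷ fv M ∷ [])
    = ⊢-lamT xs len xs∉M (exch (⊩⇒⊢ (f xs len uniq xs∉L) (Valid-↭ (↭-sym π) vxs)) π)
    where
    π : bangs Θ ++ pvars xs ++ Λ ↭ pvars xs ++ bangs Θ ++ Λ
    π = shifts (bangs Θ) (pvars xs)
    vxs : ValidEnv (pvars xs ++ bangs Θ ++ Λ)
    vxs = Valid-pvars-++ xs (bangs Θ ++ Λ) uniq
                         (All.zipWith (λ (x∉Θ , x∉Λ) → ∉-cvars-bangs-++ Θ Λ x∉Θ x∉Λ) (xs∉Θ , xs∉Λ)) v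
  ⊩⇒⊢ {Θ} {Λ} (⊩ƛ! {M = M} L f) v
    with x , x∉L ∷ x∉Θ ∷ x∉Λ ∷ x∉M ∷ [] ← fresh-name (L ∷ Θ ∷ cvars Λ ∷ fv M ∷ [])
    = lamB x x∉M (⊩⇒⊢ (f x x∉L)
                      (Valid-bangs-++ (x ∷ []) (bangs Θ ++ Λ) ([] ∷ []) (∉-cvars-bangs-++ Θ Λ x∉Θ x∉Λ ∷ []) v))
  ⊩⇒⊢ {Θ} (⊩exch d π) v = exch (⊩⇒⊢ d (Valid-↭ (++⁺ˡ (bangs Θ) (↭-sym π)) v)) (++⁺ˡ (bangs Θ) π)

  ⊩⇒⊢* : ∀ {Θ Λs Ms} → Θ ∣ Λs ⊩* Ms → ValidEnv (bangs Θ ++ concat Λs) → Shared Θ Λs Ms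
  ⊩⇒⊢* []                     _ = []
  ⊩⇒⊢* {Θ} {Λ ∷ Λs} (d ∷ ds) v =
    ⊩⇒⊢ d (Valid-++-take (bangs Θ) Λ (concat Λs) v) ∷ ⊩⇒⊢* ds (Valid-++-drop (bangs Θ) Λ (concat Λs) v)

qvars-qits : ∀ qs → qvars (map qit qs) ≡ qs
qvars-qits []       = refl
qvars-qits (q ∷ qs) = cong (q ∷_) (qvars-qits qs)

cvars-qits : ∀ qs → cvars (map qit qs) ≡ []
cvars-qits []       = refl
cvars-qits (q ∷ qs) = cvars-qits qs

unrestricted-qits : ∀ qs → unrestricted (map qit qs) ≡ []
unrestricted-qits []       = refl
unrestricted-qits (q ∷ qs) = unrestricted-qits qs

linear-qits : ∀ qs → linear (map qit qs) ≡ map qit qs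
linear-qits []       = refl
linear-qits (q ∷ qs) = cong (qit q ∷_) (linear-qits qs)

Valid-qits : ∀ {qs} → Unique qs → ValidEnv (map qit qs)
Valid-qits {qs} uniq = subst Unique (sym (cvars-qits qs)) [] , subst Unique (sym (qvars-qits qs)) uniq

⊩-Qv-qits : ∀ {Θ qs M} → Θ ∣ map qit qs ⊩ M → qs ↭ Qv M
⊩-Qv-qits {qs = qs} d = ↭-trans (↭-reflexive (sym (qvars-qits qs))) (⊩-Qv d)

⊢⇒⊩-qits : ∀ {qs M} → map qit qs ⊢ M → [] ∣ map qit qs ⊩ M
⊢⇒⊩-qits {qs} {M} d = subst₂ (_∣_⊩ M) (unrestricted-qits qs) (linear-qits qs) (⊢⇒⊩ d)

⊩-WellFormed : Term → Set
⊩-WellFormed M = ∃ λ qs → Unique qs × [] ∣ map qit qs ⊩ M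

module _ (𝓜 : QModel) where
  open Reduction 𝓜

  ⟶*-preserves-⊩ : ∀ {C D} → C ⟶* D → ⊩-WellFormed (Conf.tm C) → ⊩-WellFormed (Conf.tm D)
  ⟶*-preserves-⊩ ε w = w
  ⟶*-preserves-⊩ ((wf , red) ◅ reds) (qs , uniq , d) with ⊩-subject-reduction 𝓜 red d
  ... | _ , none , d′      = ⟶*-preserves-⊩ reds (qs , uniq , d′)
  ... | _ , one r r∉V , d′ = ⟶*-preserves-⊩ reds (r ∷ qs , ¬Any⇒All¬ qs r∉qs ∷ uniq , d′)
    where
    r∉qs : r ∉ qs
    r∉qs r∈qs = r∉V (proj₁ (proj₂ wf) r (∈-resp-↭ (⊩-Qv-qits d) r∈qs))

mainTheorem3 : (𝓜 : QModel) →
    ∀ (Q : QModel.State 𝓜) (QV : List ℕ) (M : Term)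
      (Q' : QModel.State 𝓜) (QV' : List ℕ) (M' : Term) →
    WellFormedTerm M →
    Reduction._⟶*_ 𝓜 (Reduction.⟪_,_,_⟫ Q QV M) (Reduction.⟪_,_,_⟫ Q' QV' M') →
    WellFormedTerm M'
mainTheorem3 𝓜 Q QV M Q' QV' M' (qs , uniq , _ , ⊢M) reds
  with qs′ , uniq′ , ⊩M′ ← ⟶*-preserves-⊩ 𝓜 reds (qs , uniq , ⊢⇒⊩-qits ⊢M)
  = qs′ , uniq′ , (λ r → ∈-resp-↭ π , ∈-resp-↭ (↭-sym π)) , ⊩⇒⊢ ⊩M′ (Valid-qits uniq′)
  where
  π : qs′ ↭ Qv M'
  π = ⊩-Qv-qits ⊩M′
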